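{- Let $\Sigma$ be a self-converse oriented graph on $n$ vertices such that $\det W(\Sigma)\neq 0$, and let $p$ be an odd prime. Suppose that $\mathrm{rank}_p\,W(\Sigma)=n-1$, where $\mathrm{rank}_p$ denotes rank over $\mathbb{F}_p$. Then $\ker W(\Sigma)^{\mathrm T}\subset\mathbb{F}_p^n$ is anisotropic; that is, if $v\in\mathbb{F}_p^n$, $v\neq 0$, and $W(\Sigma)^{\mathrm T}v=0$ over $\mathbb{F}_p$, then $v^{\mathrm T}v\neq 0$ in $\mathbb{F}_p$.
   Context: An oriented graph $\Sigma$ on vertex set $\{v_1,\dots,v_n\}$ is a simple graph in which every edge has been given a direction. Its skew adjacency matrix $S=S(\Sigma)=(S_{ij})$ is the $n\times n$ matrix with $S_{ij}=1$ if $(v_i,v_j)$ is a (directed) edge, $S_{ij}=-1$ if $(v_j,v_i)$ is an edge, and $S_{ij}=0$ otherwise. The walk-matrix of $\Sigma$ is $W(\Sigma)=[e,Se,\ldots,S^{n-1}e]$, where $e$ is the all-ones vector. $\Sigma$ is self-converse if there is a permutation matrix $P$ with $P^{\mathrm T}SP=S^{\mathrm T}=-S$ (equivalently, $\Sigma$ is isomorphic to the oriented graph obtained by reversing all its edges). A subspace $U\subset\mathbb{F}_p^n$ is anisotropic if $u^{\mathrm T}u\neq0$ for every nonzero $u\in U$. -}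

module Defs where

open import Algebra.Bundles using (CommutativeRing; Semiring)
open import Data.Bool.Base using (if_then_else_)
open import Data.Fin.Base using (Fin; zero; suc; toℕ; punchIn)
open import Data.Fin.Permutation using (Permutation′; _⟨$⟩ʳ_)
open import Data.Fin.Properties using (_≟_)
open import Data.Integer.Base as ℤ using (ℤ; +_; 0ℤ; 1ℤ; -1ℤ)
open import Data.Integer.Divisibility.Signed using (_∣_; divides; ∣m∣n⇒∣m+n; ∣m⇒∣-m; ∣n⇒∣m*n; ∣m⇒∣m*n)
import Data.Integer.Properties as ℤ
open import Data.Integer.Tactic.RingSolver using (solve-∀)
open import Data.Nat.Base using (ℕ; zero; suc)
open import Data.Product.Base using (_,_; ∃-syntax)
open import Data.Vec.Functional using (Vector; replicate)
open import Level using (Level; 0ℓ; _⊔_)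
open import Relation.Binary.Core using (Rel)
open import Relation.Binary.Definitions using (Asymmetric; Decidable)
open import Relation.Binary.PropositionalEquality using (_≡_; refl; subst)
open import Relation.Nullary using (¬_; does)
open import Relation.Unary using (Pred)

-- A matrix is the vector of its rows: M i j is the entry in row i, column j.
Matrix : ∀ {a} → Set a → ℕ → ℕ → Set a
Matrix A m n = Vector (Vector A n) m

_ᵀ : ∀ {a} {A : Set a} {m n} → Matrix A m n → Matrix A n m
(M ᵀ) i j = M j i

infix 10 _ᵀ

module LinearAlgebra {c ℓ : Level} (R : CommutativeRing c ℓ) where

  open CommutativeRing R hiding (zero)
  open import Algebra.Definitions.RawMonoid +-rawMonoid using (sum)
  open import Algebra.Definitions.RawSemiring (Semiring.rawSemiring semiring) using (_^_)
  open import Data.Vec.Functional.Relation.Binary.Equality.Setoid setoid using (_≋_)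

  infixl 7 _*ᴹ_ _*ⱽ_ _∙_
  infixr 8 _^ᴹ_
  infix  4 _≈ᴹ_

  _≈ᴹ_ : ∀ {m n} → Matrix Carrier m n → Matrix Carrier m n → Set ℓ
  M ≈ᴹ N = ∀ i j → M i j ≈ N i j

  0ⱽ : ∀ {n} → Vector Carrier n
  0ⱽ = replicate _ 0#

  _∙_ : ∀ {n} → Vector Carrier n → Vector Carrier n → Carrier
  u ∙ v = sum (λ i → u i * v i)

  _*ⱽ_ : ∀ {m n} → Matrix Carrier m n → Vector Carrier n → Vector Carrier m
  (M *ⱽ v) i = M i ∙ v

  _*ᴹ_ : ∀ {m n k} → Matrix Carrier m n → Matrix Carrier n k → Matrix Carrier m k
  (M *ᴹ N) i j = M i ∙ (N ᵀ) j

  1ᴹ : ∀ {n} → Matrix Carrier n n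
  1ᴹ i j = if does (i ≟ j) then 1# else 0#

  _^ᴹ_ : ∀ {n} → Matrix Carrier n n → ℕ → Matrix Carrier n n
  M ^ᴹ zero  = 1ᴹ
  M ^ᴹ suc k = M *ᴹ (M ^ᴹ k)

  permutationMatrix : ∀ {n} → Permutation′ n → Matrix Carrier n n
  permutationMatrix π i j = if does (π ⟨$⟩ʳ i ≟ j) then 1# else 0#

  -- Laplace expansion along the first row.
  det : ∀ {n} → Matrix Carrier n n → Carrier
  det {zero}  M = 1#
  det {suc n} M = sum λ j → (- 1#) ^ toℕ j * M zero j * det (λ i k → M (suc i) (punchIn j k))

  linearCombination : ∀ {n r} → Vector Carrier r → Vector (Vector Carrier n) r → Vector Carrier n
  linearCombination a b j = sum (λ i → a i * b i j)

  LinearlyIndependent : ∀ {n r} → Vector (Vector Carrier n) r → Set (c ⊔ ℓ)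
  LinearlyIndependent b = ∀ a → linearCombination a b ≋ 0ⱽ → a ≋ 0ⱽ

  record IsBasis {n r} {u} (U : Pred (Vector Carrier n) u)
                 (b : Vector (Vector Carrier n) r) : Set (c ⊔ ℓ ⊔ u) where
    field
      member      : ∀ i → U (b i)
      independent : LinearlyIndependent b
      spanning    : ∀ v → U v → ∃[ a ] linearCombination a b ≋ v

  ColumnSpace : ∀ {m n} → Matrix Carrier m n → Pred (Vector Carrier m) (c ⊔ ℓ)
  ColumnSpace M v = ∃[ x ] M *ⱽ x ≋ v

  Kernel : ∀ {m n} → Matrix Carrier m n → Pred (Vector Carrier n) ℓ
  Kernel M v = M *ⱽ v ≋ 0ⱽ

  -- The dimension of the column space is r; meant for R a field, where
  -- such an r is unique.
  HasRank : ∀ {m n} → Matrix Carrier m n → ℕ → Set (c ⊔ ℓ)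
  HasRank {m} M r = ∃[ b ] IsBasis {m} {r} (ColumnSpace M) b

  Anisotropic : ∀ {n u} → Pred (Vector Carrier n) u → Set (c ⊔ ℓ ⊔ u)
  Anisotropic U = ∀ v → U v → ¬ (v ≋ 0ⱽ) → ¬ (v ∙ v ≈ 0#)

-- There are no quotient types: ℤ/ p is ℤ with congruence as setoid equality.
record Congruent (p : ℕ) (x y : ℤ) : Set where
  constructor congruent
  field
    p∣x-y : + p ∣ x ℤ.- y

private
  module _ (p : ℕ) where

    ≡⇒Congruent : ∀ {x y} → x ≡ y → Congruent p x y
    ≡⇒Congruent {x} refl = congruent (divides 0ℤ (ℤ.+-inverseʳ x))

    sym′ : ∀ {x y} → Congruent p x y → Congruent p y x
    sym′ {x} {y} (congruent d) = congruent (subst (+ p ∣_) (lemma x y) (∣m⇒∣-m d))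
      where
      lemma : ∀ x y → ℤ.- (x ℤ.- y) ≡ y ℤ.- x
      lemma = solve-∀

    trans′ : ∀ {x y z} → Congruent p x y → Congruent p y z → Congruent p x z
    trans′ {x} {y} {z} (congruent d) (congruent e) =
      congruent (subst (+ p ∣_) (lemma x y z) (∣m∣n⇒∣m+n d e))
      where
      lemma : ∀ x y z → (x ℤ.- y) ℤ.+ (y ℤ.- z) ≡ x ℤ.- z
      lemma = solve-∀

    +-cong′ : ∀ {x y u v} → Congruent p x y → Congruent p u v → Congruent p (x ℤ.+ u) (y ℤ.+ v)
    +-cong′ {x} {y} {u} {v} (congruent d) (congruent e) =
      congruent (subst (+ p ∣_) (lemma x y u v) (∣m∣n⇒∣m+n d e))
      where
      lemma : ∀ x y u v → (x ℤ.- y) ℤ.+ (u ℤ.- v) ≡ (x ℤ.+ u) ℤ.- (y ℤ.+ v)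
      lemma = solve-∀

    *-cong′ : ∀ {x y u v} → Congruent p x y → Congruent p u v → Congruent p (x ℤ.* u) (y ℤ.* v)
    *-cong′ {x} {y} {u} {v} (congruent d) (congruent e) =
      congruent (subst (+ p ∣_) (lemma x y u v) (∣m∣n⇒∣m+n (∣m⇒∣m*n u d) (∣n⇒∣m*n y e)))
      where
      lemma : ∀ x y u v → (x ℤ.- y) ℤ.* u ℤ.+ y ℤ.* (u ℤ.- v) ≡ x ℤ.* u ℤ.- y ℤ.* v
      lemma = solve-∀

    neg-cong′ : ∀ {x y} → Congruent p x y → Congruent p (ℤ.- x) (ℤ.- y)
    neg-cong′ {x} {y} (congruent d) = congruent (subst (+ p ∣_) (lemma x y) (∣m⇒∣-m d))
      where
      lemma : ∀ x y → ℤ.- (x ℤ.- y) ≡ (ℤ.- x) ℤ.- (ℤ.- y)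
      lemma = solve-∀

ℤ/_ : ℕ → CommutativeRing 0ℓ 0ℓ
ℤ/ p = record
  { Carrier = ℤ
  ; _≈_ = Congruent p
  ; _+_ = ℤ._+_
  ; _*_ = ℤ._*_
  ; -_  = ℤ.-_
  ; 0#  = 0ℤ
  ; 1#  = 1ℤ
  ; isCommutativeRing = record
    { isRing = record
      { +-isAbelianGroup = record
        { isGroup = record
          { isMonoid = record
            { isSemigroup = record
              { isMagma = record
                { isEquivalence = record
                  { refl = ≡⇒Congruent p refl
                  ; sym = sym′ p
                  ; trans = trans′ p
                  }
                ; ∙-cong = +-cong′ p
                }
              ; assoc = λ x y z → ≡⇒Congruent p (ℤ.+-assoc x y z)
              }
            ; identity = (λ x → ≡⇒Congruent p (ℤ.+-identityˡ x))
                       , (λ x → ≡⇒Congruent p (ℤ.+-identityʳ x))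
            }
          ; inverse = (λ x → ≡⇒Congruent p (ℤ.+-inverseˡ x))
                    , (λ x → ≡⇒Congruent p (ℤ.+-inverseʳ x))
          ; ⁻¹-cong = neg-cong′ p
          }
        ; comm = λ x y → ≡⇒Congruent p (ℤ.+-comm x y)
        }
      ; *-cong = *-cong′ p
      ; *-assoc = λ x y z → ≡⇒Congruent p (ℤ.*-assoc x y z)
      ; *-identity = (λ x → ≡⇒Congruent p (ℤ.*-identityˡ x))
                   , (λ x → ≡⇒Congruent p (ℤ.*-identityʳ x))
      ; distrib = (λ x y z → ≡⇒Congruent p (ℤ.*-distribˡ-+ x y z))
                , (λ x y z → ≡⇒Congruent p (ℤ.*-distribʳ-+ x y z))
      }
    ; *-comm = λ x y → ≡⇒Congruent p (ℤ.*-comm x y)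
    }
  }

-- Entrywise reduction; the identity on representatives.
_mod_ : ∀ {m n} → Matrix ℤ m n → (p : ℕ) → Matrix (CommutativeRing.Carrier (ℤ/ p)) m n
(M mod p) i j = M i j

module Overℤ = LinearAlgebra ℤ.+-*-commutativeRing
module Over𝔽 (p : ℕ) = LinearAlgebra (ℤ/ p)

-- Asymmetry gives both the absence of loops and that each edge carries
-- exactly one direction.
record OrientedGraph (n : ℕ) : Set₁ where
  field
    _⟶_  : Rel (Fin n) 0ℓ
    asym : Asymmetric _⟶_
    _⟶?_ : Decidable _⟶_

module _ {n : ℕ} (Σ : OrientedGraph n) where

  open OrientedGraph Σ
  open Overℤ

  skewAdjacency : Matrix ℤ n n
  skewAdjacency i j =
    if does (i ⟶? j) then 1ℤ else
    if does (j ⟶? i) then -1ℤ else 0ℤ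

  walkMatrix : Matrix ℤ n n
  walkMatrix i k = ((skewAdjacency ^ᴹ toℕ k) *ⱽ replicate n 1ℤ) i

  SelfConverse : Set
  SelfConverse = ∃[ π ] let P = permutationMatrix π; S = skewAdjacency in
    P ᵀ *ᴹ S *ᴹ P ≈ᴹ S ᵀ

{-# OPTIONS --safe #-}

-- Let w k = Sᵏe, let n = r + 1, and let σ be the permutation with S (σ i) (σ j) = - S i j, so that w k ∘ σ = (-1)ᵏ w k.
-- Over ℤ, det W ≠ 0 makes σ an involution (rows i and σ (σ i) of W agree), and a dimension count in the eigenspaces
-- of σ shows that σ has no fixed point when n is even; when n is odd it has one.
-- Modulo p the left kernel of W is a line, stable under S and under v ↦ v ∘ σ. Since S anticommutes with σ, S v = 0
-- for v in it. If moreover vᵀv = 0, then v is a combination of w 0, …, w (n - 2) in which w (n - 2) occurs, so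
-- v ∘ σ = (-1)ⁿ v. But S exchanges the two eigenspaces of σ, and a dimension count turns v into a nonzero u with
-- S u = 0, eᵀu = 0 and u ∘ σ = - (-1)ⁿ u. This u lies on the same line as v, although its parity differs.
-- All dimension counts are made without division, over a domain with decidable equality.
module Submission where

open import Defs
import Level
open import Level using (_⊔_; 0ℓ)
open import Algebra.Bundles using (CommutativeRing; Semiring)
open import Algebra.Solver.Ring.AlmostCommutativeRing using (fromCommutativeRing; _-Raw-AlmostCommutative⟶_)
open import Data.Empty using (⊥)
open import Data.Fin.Base using (Fin; zero; suc; toℕ; fromℕ; inject₁; punchIn; punchOut; _<_)
open import Data.Fin.Induction using (<-weakInduction)
open import Data.Fin.Permutation using (Permutation′; _⟨$⟩ʳ_; _⟨$⟩ˡ_; inverseʳ)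
open import Data.Fin.Properties using (_≟_; any?; <-cmp; toℕ-inject₁; toℕ-fromℕ; punchInᵢ≢i; punchIn-punchOut; punchOut-punchIn; punchOut-cong)
open import Data.Fin.Relation.Unary.Top using (View; view; ‵fromℕ; ‵inject₁)
open import Data.Integer.Base as ℤ using (ℤ; +_; -[1+_]; _⊖_; 0ℤ; 1ℤ)
import Data.Integer.Divisibility.Signed as ℤ
import Data.Integer.Properties as ℤ
open import Data.Maybe.Base using (map)
open import Data.Nat.Base as ℕ using (ℕ; zero; suc)
open import Data.Nat.Divisibility using (_∣_)
import Data.Nat.Divisibility as ℕ
open import Data.Nat.Primality using (Prime; euclidsLemma; prime⇒nonTrivial)
import Data.Nat.Properties as ℕ
open import Data.Product.Base using (_×_; _,_; ∃-syntax; proj₁; proj₂)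
open import Data.Sum.Base as Sum using (_⊎_; inj₁; inj₂; [_,_]′)
open import Data.Vec.Functional using (Vector; _∷_; tail; init; last; insertAt; replicate)
open import Data.Vec.Functional.Properties using (insertAt-lookup)
open import Function.Base using (_∘_; id)
open import Function.Bundles using (Injection)
open import Function.Properties.Inverse using (↔⇒↣)
open import Relation.Binary.Consequences using (dec⇒weaklyDec)
open import Relation.Binary.Definitions using (Decidable; tri<; tri≈; tri>)
open import Relation.Binary.PropositionalEquality as ≡ using (_≡_; _≢_)
open import Relation.Nullary using (¬_; Dec; yes; no; contradiction; ¬?)
open import Relation.Nullary.Decidable using (decidable-stable; map′)

-- The facts about `σ` concern a permutation only, so they are proved over ℤ, where `W` is
-- nonsingular, and reused modulo `p`, where it is not. The parity of `n` is what makes the last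
-- dimension count come out. Put `ε` = (-1)ⁿ. `S` maps the (-`ε`)-eigenspace of `σ` into the
-- `ε`-eigenspace, and since `S v` = 0 its image is orthogonal to `v`, which lies in the latter. If
-- `n` is even, there is no fixed point, both eigenspaces have dimension n/2, and so `S` kills some
-- nonzero `u` in the (-1)-eigenspace; there eᵀu = 0 is automatic, because the entries of `u` cancel
-- in pairs. If `n` is odd, then `ε` = -1, and every fixed point makes the (+1)-eigenspace one
-- dimension larger than the (-1)-eigenspace. One such surplus dimension pays for the extra equation
-- eᵀu = 0, without which `S u` = 0 would not place `u` in the left kernel of `W`. Both cases are
-- handled by one square matrix `M`: a left null vector built from `v` forces a right null vector,
-- and no dimension is ever computed.

-- With coefficients in ℤ the solver can cancel terms, which it cannot with coefficients in an abstract R.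
module IntegerCoefficients {c ℓ} (R : CommutativeRing c ℓ) where

  open CommutativeRing R hiding (zero)
  open import Algebra.Properties.Ring ring
  open import Algebra.Properties.AbelianGroup +-abelianGroup using (⁻¹-∙-comm)
  open import Algebra.Properties.Group +-group using (⁻¹-involutive; ε⁻¹≈ε)
  open import Algebra.Properties.Semiring.Mult.TCOptimised semiring
    using (×-homo-+; ×1-homo-*) renaming (_×_ to _·_)
  open import Relation.Binary.Reasoning.Setoid setoid

  ⟦_⟧ : ℤ → Carrier
  ⟦ + n      ⟧ = n · 1#
  ⟦ -[1+ n ] ⟧ = - (suc n · 1#)

  ⟦⟧-⊖ : ∀ m n → ⟦ m ⊖ n ⟧ ≈ m · 1# - n · 1#
  ⟦⟧-⊖ m zero = sym (trans (+-congˡ ε⁻¹≈ε) (+-identityʳ _))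
  ⟦⟧-⊖ zero (suc n) = sym (+-identityˡ _)
  ⟦⟧-⊖ (suc m) (suc n) = begin
    ⟦ suc m ⊖ suc n ⟧                        ≡⟨ ≡.cong ⟦_⟧ (ℤ.[1+m]⊖[1+n]≡m⊖n m n) ⟩
    ⟦ m ⊖ n ⟧                                ≈⟨ ⟦⟧-⊖ m n ⟩
    m · 1# - n · 1#                          ≈⟨ +-identityˡ _ ⟨
    0# + (m · 1# - n · 1#)                   ≈⟨ +-congʳ (-‿inverseʳ 1#) ⟨
    (1# - 1#) + (m · 1# - n · 1#)            ≈⟨ interchange _ _ _ _ ⟩
    (1# + m · 1#) + (- 1# - n · 1#)          ≈⟨ +-congˡ (⁻¹-∙-comm _ _) ⟩
    (1# + m · 1#) - (1# + n · 1#)            ≈⟨ +-cong (×-homo-+ 1# 1 m) (-‿cong (×-homo-+ 1# 1 n)) ⟨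
    suc m · 1# - suc n · 1#                  ∎
    where
    open import Algebra.Properties.CommutativeSemigroup +-commutativeSemigroup using (interchange)

  ⟦⟧-neg : ∀ i → ⟦ ℤ.- i ⟧ ≈ - ⟦ i ⟧
  ⟦⟧-neg (+ zero)  = sym ε⁻¹≈ε
  ⟦⟧-neg (+ suc n) = refl
  ⟦⟧-neg -[1+ n ]  = sym (⁻¹-involutive _)

  ⟦⟧-+ : ∀ i j → ⟦ i ℤ.+ j ⟧ ≈ ⟦ i ⟧ + ⟦ j ⟧
  ⟦⟧-+ (+ m)    (+ n)    = ×-homo-+ 1# m n
  ⟦⟧-+ (+ m)    -[1+ n ] = ⟦⟧-⊖ m (suc n)
  ⟦⟧-+ -[1+ m ] (+ n)    = trans (⟦⟧-⊖ n (suc m)) (+-comm _ _)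
  ⟦⟧-+ -[1+ m ] -[1+ n ] = begin
    - (suc (suc (m ℕ.+ n)) · 1#)      ≡⟨ ≡.cong (λ k → - (suc k · 1#)) (≡.sym (ℕ.+-suc m n)) ⟩
    - ((suc m ℕ.+ suc n) · 1#)        ≈⟨ -‿cong (×-homo-+ 1# (suc m) (suc n)) ⟩
    - (suc m · 1# + suc n · 1#)       ≈⟨ ⁻¹-∙-comm _ _ ⟨
    - (suc m · 1#) - suc n · 1#       ∎

  ⟦⟧-*⁺ : ∀ m j → ⟦ + m ℤ.* j ⟧ ≈ ⟦ + m ⟧ * ⟦ j ⟧
  ⟦⟧-*⁺ m (+ n) = begin
    ⟦ + m ℤ.* + n ⟧       ≡⟨ ≡.cong ⟦_⟧ (ℤ.pos-* m n) ⟨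
    (m ℕ.* n) · 1#        ≈⟨ ×1-homo-* m n ⟩
    (m · 1#) * (n · 1#)   ∎
  ⟦⟧-*⁺ m -[1+ n ] = begin
    ⟦ + m ℤ.* -[1+ n ] ⟧         ≡⟨ ≡.cong ⟦_⟧ (ℤ.neg-distribʳ-* (+ m) (+ suc n)) ⟨
    ⟦ ℤ.- (+ m ℤ.* + suc n) ⟧    ≈⟨ ⟦⟧-neg (+ m ℤ.* + suc n) ⟩
    - ⟦ + m ℤ.* + suc n ⟧        ≈⟨ -‿cong (⟦⟧-*⁺ m (+ suc n)) ⟩
    - (⟦ + m ⟧ * ⟦ + suc n ⟧)    ≈⟨ -‿distribʳ-* _ _ ⟩
    ⟦ + m ⟧ * ⟦ -[1+ n ] ⟧       ∎

  ⟦⟧-* : ∀ i j → ⟦ i ℤ.* j ⟧ ≈ ⟦ i ⟧ * ⟦ j ⟧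
  ⟦⟧-* (+ m)    j = ⟦⟧-*⁺ m j
  ⟦⟧-* -[1+ m ] j = begin
    ⟦ -[1+ m ] ℤ.* j ⟧           ≡⟨ ≡.cong ⟦_⟧ (ℤ.neg-distribˡ-* (+ suc m) j) ⟨
    ⟦ ℤ.- (+ suc m ℤ.* j) ⟧      ≈⟨ ⟦⟧-neg (+ suc m ℤ.* j) ⟩
    - ⟦ + suc m ℤ.* j ⟧          ≈⟨ -‿cong (⟦⟧-*⁺ (suc m) j) ⟩
    - (⟦ + suc m ⟧ * ⟦ j ⟧)      ≈⟨ -‿distribˡ-* _ _ ⟩
    ⟦ -[1+ m ] ⟧ * ⟦ j ⟧         ∎

  ℤ⟶R : CommutativeRing.rawRing ℤ.+-*-commutativeRing -Raw-AlmostCommutative⟶ fromCommutativeRing R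
  ℤ⟶R = record
    { ⟦_⟧    = ⟦_⟧
    ; +-homo = ⟦⟧-+
    ; *-homo = ⟦⟧-*
    ; -‿homo = ⟦⟧-neg
    ; 0-homo = refl
    ; 1-homo = refl
    }

  open import Algebra.Solver.Ring
    (CommutativeRing.rawRing ℤ.+-*-commutativeRing) (fromCommutativeRing R) ℤ⟶R
    (λ i j → map (λ i≡j → reflexive (≡.cong ⟦_⟧ i≡j)) (dec⇒weaklyDec ℤ._≟_ i j))
    public using (solve; _:=_; _:+_; _:*_; _:-_; :-_; con)

-- Finite sums, dot products and permutation matrices

module FiniteSums {c ℓ} (R : CommutativeRing c ℓ) where

  open CommutativeRing R hiding (zero)
  open LinearAlgebra R
  open IntegerCoefficients R
  open import Algebra.Properties.Semiring.Sum semiring public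
  open import Relation.Binary.Reasoning.Setoid setoid

  sum-zero : ∀ {n} {f : Vector Carrier n} → (∀ i → f i ≈ 0#) → sum f ≈ 0#
  sum-zero {n} f≈0 = trans (sum-cong-≋ f≈0) (sum-replicate-zero n)

  sum-single : ∀ {n} (f : Vector Carrier n) i → (∀ j → j ≢ i → f j ≈ 0#) → sum f ≈ f i
  sum-single {suc n} f i f≈0 = begin
    sum f                        ≈⟨ sum-remove {i = i} f ⟩
    f i + sum (f ∘ punchIn i)    ≈⟨ +-congˡ (sum-zero λ j → f≈0 (punchIn i j) (punchInᵢ≢i i j)) ⟩
    f i + 0#                     ≈⟨ +-identityʳ _ ⟩
    f i                          ∎

  1ᴹ-diagonal : ∀ {n} (i : Fin n) → 1ᴹ i i ≈ 1#
  1ᴹ-diagonal i with i ≟ i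
  ... | yes _  = refl
  ... | no i≢i = contradiction ≡.refl i≢i

  1ᴹ-offDiagonal : ∀ {n} {i j : Fin n} → i ≢ j → 1ᴹ i j ≈ 0#
  1ᴹ-offDiagonal {i = i} {j} i≢j with i ≟ j
  ... | yes i≡j = contradiction i≡j i≢j
  ... | no _    = refl

  1ᴹ-∙ : ∀ {n} (i : Fin n) v → 1ᴹ i ∙ v ≈ v i
  1ᴹ-∙ i v = begin
    1ᴹ i ∙ v       ≈⟨ sum-single _ i (λ j j≢i → trans (*-congʳ (1ᴹ-offDiagonal (j≢i ∘ ≡.sym))) (zeroˡ _)) ⟩
    1ᴹ i i * v i   ≈⟨ *-congʳ (1ᴹ-diagonal i) ⟩
    1# * v i       ≈⟨ *-identityˡ _ ⟩
    v i            ∎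

  ∙-1ᴹ : ∀ {n} (v : Vector Carrier n) j → v ∙ (λ i → 1ᴹ i j) ≈ v j
  ∙-1ᴹ v j = begin
    v ∙ (λ i → 1ᴹ i j)   ≈⟨ sum-single _ j (λ i i≢j → trans (*-congˡ (1ᴹ-offDiagonal i≢j)) (zeroʳ _)) ⟩
    v j * 1ᴹ j j         ≈⟨ *-congˡ (1ᴹ-diagonal j) ⟩
    v j * 1#             ≈⟨ *-identityʳ _ ⟩
    v j                  ∎

  ∙-comm : ∀ {n} (u v : Vector Carrier n) → u ∙ v ≈ v ∙ u
  ∙-comm u v = sum-cong-≋ λ i → *-comm (u i) (v i)

  ∙-congˡ : ∀ {n} (u : Vector Carrier n) {v w} → (∀ i → v i ≈ w i) → u ∙ v ≈ u ∙ w
  ∙-congˡ u v≈w = sum-cong-≋ λ i → *-congˡ (v≈w i)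

  ∙-congʳ : ∀ {n} (u : Vector Carrier n) {v w} → (∀ i → v i ≈ w i) → v ∙ u ≈ w ∙ u
  ∙-congʳ u v≈w = sum-cong-≋ λ i → *-congʳ (v≈w i)

  ∙-zeroʳ : ∀ {n} (u : Vector Carrier n) {v} → (∀ i → v i ≈ 0#) → u ∙ v ≈ 0#
  ∙-zeroʳ u v≈0 = sum-zero λ i → trans (*-congˡ (v≈0 i)) (zeroʳ _)

  ∙-zeroˡ : ∀ {n} (u : Vector Carrier n) {v} → (∀ i → v i ≈ 0#) → v ∙ u ≈ 0#
  ∙-zeroˡ u v≈0 = sum-zero λ i → trans (*-congʳ (v≈0 i)) (zeroˡ _)

  ∙-linear : ∀ {n} (u : Vector Carrier n) x v y w →
             u ∙ (λ i → x * v i + y * w i) ≈ x * (u ∙ v) + y * (u ∙ w)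
  ∙-linear u x v y w = begin
    u ∙ (λ i → x * v i + y * w i)
      ≈⟨ sum-cong-≋ (λ i → solve 5 (λ u x v y w → u :* (x :* v :+ y :* w) := x :* (u :* v) :+ y :* (u :* w)) refl (u i) x (v i) y (w i)) ⟩
    sum (λ i → x * (u i * v i) + y * (u i * w i))
      ≈⟨ ∑-distrib-+ (λ i → x * (u i * v i)) (λ i → y * (u i * w i)) ⟩
    sum (λ i → x * (u i * v i)) + sum (λ i → y * (u i * w i))
      ≈⟨ +-cong (*-distribˡ-sum x (λ i → u i * v i)) (*-distribˡ-sum y (λ i → u i * w i)) ⟨
    x * (u ∙ v) + y * (u ∙ w)  ∎

  ∙-scaleʳ : ∀ {n} (u : Vector Carrier n) x v → u ∙ (λ i → x * v i) ≈ x * (u ∙ v)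
  ∙-scaleʳ u x v = begin
    sum (λ i → u i * (x * v i))  ≈⟨ sum-cong-≋ (λ i → solve 3 (λ u x v → u :* (x :* v) := x :* (u :* v)) refl (u i) x (v i)) ⟩
    sum (λ i → x * (u i * v i))  ≈⟨ *-distribˡ-sum x (λ i → u i * v i) ⟨
    x * (u ∙ v)                  ∎

  neg-∙ : ∀ {n} (u v : Vector Carrier n) → (λ i → - u i) ∙ v ≈ - (u ∙ v)
  neg-∙ u v = begin
    sum (λ i → - u i * v i)          ≈⟨ sum-cong-≋ (λ i → solve 2 (λ u v → :- u :* v := :- con (+ 1) :* (u :* v)) refl (u i) (v i)) ⟩
    sum (λ i → - 1# * (u i * v i))   ≈⟨ *-distribˡ-sum (- 1#) (λ i → u i * v i) ⟨
    - 1# * (u ∙ v)                   ≈⟨ solve 1 (λ x → :- con (+ 1) :* x := :- x) refl _ ⟩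
    - (u ∙ v)                        ∎

  ∙-adjoint : ∀ {m n} (u : Vector Carrier m) (M : Matrix Carrier m n) v →
              u ∙ (M *ⱽ v) ≈ (M ᵀ *ⱽ u) ∙ v
  ∙-adjoint u M v = begin
    sum (λ i → u i * sum (λ j → M i j * v j))
      ≈⟨ sum-cong-≋ (λ i → *-distribˡ-sum (u i) (λ j → M i j * v j)) ⟩
    sum (λ i → sum (λ j → u i * (M i j * v j)))
      ≈⟨ ∑-comm (λ i j → u i * (M i j * v j)) ⟩
    sum (λ j → sum (λ i → u i * (M i j * v j)))
      ≈⟨ sum-cong-≋ (λ j → sum-cong-≋ λ i → solve 3 (λ u m v → u :* (m :* v) := (m :* u) :* v) refl (u i) (M i j) (v j)) ⟩
    sum (λ j → sum (λ i → (M i j * u i) * v j))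
      ≈⟨ sum-cong-≋ (λ j → *-distribʳ-sum (v j) (λ i → M i j * u i)) ⟨
    sum (λ j → sum (λ i → M i j * u i) * v j) ∎

  *ᴹ-*ⱽ-assoc : ∀ {l m n} (M : Matrix Carrier l m) (N : Matrix Carrier m n) v i →
                ((M *ᴹ N) *ⱽ v) i ≈ (M *ⱽ (N *ⱽ v)) i
  *ᴹ-*ⱽ-assoc M N v i = begin
    (λ j → M i ∙ (N ᵀ) j) ∙ v   ≈⟨ ∙-congʳ v (λ j → ∙-comm (M i) ((N ᵀ) j)) ⟩
    (N ᵀ *ⱽ M i) ∙ v            ≈⟨ ∙-adjoint (M i) N v ⟨
    M i ∙ (N *ⱽ v)              ∎

  -- Row `a` of `permutationMatrix π` has its 1 in column `π a`, so column `π i` is the unit vector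
  -- at `i`. Reading the entry at `π i`, `π j` avoids the inverse permutation.
  permutationMatrix-conjugate : ∀ {n} (π : Permutation′ n) (M : Matrix Carrier n n) i j →
    let P = permutationMatrix π in (P ᵀ *ᴹ M *ᴹ P) (π ⟨$⟩ʳ i) (π ⟨$⟩ʳ j) ≈ M i j
  permutationMatrix-conjugate π M i j = begin
    (λ b → column i ∙ (λ a → M a b)) ∙ column j   ≈⟨ ∙-column (λ b → column i ∙ (λ a → M a b)) j ⟩
    column i ∙ (λ a → M a j)                      ≈⟨ ∙-comm (column i) (λ a → M a j) ⟩
    (λ a → M a j) ∙ column i                      ≈⟨ ∙-column (λ a → M a j) i ⟩
    M i j                                         ∎
    where
    column : Fin _ → Vector Carrier _
    column i a = 1ᴹ (π ⟨$⟩ʳ a) (π ⟨$⟩ʳ i)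

    ∙-column : ∀ v i → v ∙ column i ≈ v i
    ∙-column v i = begin
      v ∙ column i                           ≈⟨ sum-single _ i (λ a a≢i → trans (*-congˡ (1ᴹ-offDiagonal (a≢i ∘ Injection.injective (↔⇒↣ π)))) (zeroʳ _)) ⟩
      v i * 1ᴹ (π ⟨$⟩ʳ i) (π ⟨$⟩ʳ i)         ≈⟨ *-congˡ (1ᴹ-diagonal (π ⟨$⟩ʳ i)) ⟩
      v i * 1#                               ≈⟨ *-identityʳ _ ⟩
      v i                                    ∎

-- Determinants as alternating, multilinear functions of the rows

module Determinant {c ℓ} (R : CommutativeRing c ℓ) where

  open CommutativeRing R hiding (zero)
  open LinearAlgebra R
  open IntegerCoefficients R
  open FiniteSums R
  open import Algebra.Definitions.RawSemiring (Semiring.rawSemiring semiring) using (_^_)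
  open import Relation.Binary.Reasoning.Setoid setoid

  minor : ∀ {m n} → Matrix Carrier m (suc n) → Fin (suc n) → Matrix Carrier m n
  minor M j i k = M i (punchIn j k)

  det-cong : ∀ {n} {M N : Matrix Carrier n n} → M ≈ᴹ N → det M ≈ det N
  det-cong {zero}  M≈N = refl
  det-cong {suc n} M≈N = sum-cong-≋ λ j →
    *-cong (*-congˡ {(- 1#) ^ toℕ j} (M≈N zero j)) (det-cong λ i k → M≈N (suc i) (punchIn j k))

  -- Both sides enumerate, in increasing order, the columns other than `j` and `l`.
  punchIn-swap : ∀ {n} {j l : Fin (suc (suc n))} (j≢l : j ≢ l) (l≢j : l ≢ j) k →
                 punchIn j (punchIn (punchOut j≢l) k) ≡ punchIn l (punchIn (punchOut l≢j) k)
  punchIn-swap {j = zero}  {zero}  j≢l _ k = contradiction ≡.refl j≢l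
  punchIn-swap {j = zero}  {suc l} _   _ k = ≡.refl
  punchIn-swap {j = suc j} {zero}  _   _ k = ≡.refl
  punchIn-swap {suc n} {suc j} {suc l} _ _ zero = ≡.refl
  punchIn-swap {suc n} {suc j} {suc l} j≢l l≢j (suc k) =
    ≡.cong suc (punchIn-swap (j≢l ∘ ≡.cong suc) (l≢j ∘ ≡.cong suc) k)

  sgn : ∀ {n} → Fin n → Carrier
  sgn j = (- 1#) ^ toℕ j

  -- Deleting the smaller of two columns first lowers the position of the larger by one, while
  -- deleting the larger first leaves the smaller in place. The two exponents therefore differ by
  -- one.
  sgn-swap : ∀ {n} {j l : Fin (suc (suc n))} (j≢l : j ≢ l) (l≢j : l ≢ j) →
             sgn j * sgn (punchOut j≢l) ≈ - (sgn l * sgn (punchOut l≢j))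
  sgn-swap {j = zero}  {zero}  j≢l _ = contradiction ≡.refl j≢l
  sgn-swap {j = zero}  {suc l} _ _ =
    solve 1 (λ s → con (+ 1) :* s := :- ((:- con (+ 1) :* s) :* con (+ 1))) refl (sgn l)
  sgn-swap {j = suc j} {zero}  _ _ =
    solve 1 (λ s → (:- con (+ 1) :* s) :* con (+ 1) := :- (con (+ 1) :* s)) refl (sgn j)
  sgn-swap {zero}  {suc zero} {suc zero} j≢l _ = contradiction ≡.refl j≢l
  sgn-swap {suc n} {suc j} {suc l} j≢l l≢j = begin
    (- 1# * s) * (- 1# * s′)     ≈⟨ solve 2 (λ s s′ → (:- con (+ 1) :* s) :* (:- con (+ 1) :* s′) := s :* s′) refl s s′ ⟩
    s * s′                       ≈⟨ sgn-swap (j≢l ∘ ≡.cong suc) (l≢j ∘ ≡.cong suc) ⟩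
    - (t * t′)                   ≈⟨ solve 2 (λ s s′ → :- ((:- con (+ 1) :* s) :* (:- con (+ 1) :* s′)) := :- (s :* s′)) refl t t′ ⟨
    - ((- 1# * t) * (- 1# * t′)) ∎
    where
    s  = sgn j
    s′ = sgn (punchOut (j≢l ∘ ≡.cong suc))
    t  = sgn l
    t′ = sgn (punchOut (l≢j ∘ ≡.cong suc))

  -- The coefficient of a j * b l in the determinant of the matrix with rows a, b and N.
  cofactor₂ : ∀ {n} → Matrix Carrier n (suc (suc n)) → (j l : Fin (suc (suc n))) → Carrier
  cofactor₂ N j l with j ≟ l
  ... | yes _  = 0#
  ... | no j≢l = sgn j * sgn (punchOut j≢l) * det (minor (minor N j) (punchOut j≢l))

  cofactor₂-diagonal : ∀ {n} (N : Matrix Carrier n _) j → cofactor₂ N j j ≈ 0#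
  cofactor₂-diagonal N j with j ≟ j
  ... | yes _  = refl
  ... | no j≢j = contradiction ≡.refl j≢j

  cofactor₂-punchIn : ∀ {n} (N : Matrix Carrier n _) j k →
                      cofactor₂ N j (punchIn j k) ≈ sgn j * sgn k * det (minor (minor N j) k)
  cofactor₂-punchIn N j k with j ≟ punchIn j k
  ... | yes j≡ = contradiction (≡.sym j≡) (punchInᵢ≢i j k)
  ... | no j≢ = reflexive (≡.cong (λ k → sgn j * sgn k * det (minor (minor N j) k))
                  (≡.trans (punchOut-cong j ≡.refl) (punchOut-punchIn j)))

  cofactor₂-swap : ∀ {n} (N : Matrix Carrier n _) j l → cofactor₂ N j l ≈ - cofactor₂ N l j
  cofactor₂-swap N j l with j ≟ l | l ≟ j
  ... | yes _   | yes _   = solve 0 (con (+ 0) := :- con (+ 0)) refl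
  ... | yes j≡l | no l≢j  = contradiction (≡.sym j≡l) l≢j
  ... | no j≢l  | yes l≡j = contradiction (≡.sym l≡j) j≢l
  ... | no j≢l  | no l≢j  = begin
    sgn j * sgn (punchOut j≢l) * det (minor (minor N j) (punchOut j≢l))
      ≈⟨ *-cong (sgn-swap j≢l l≢j) (det-cong λ i k → reflexive (≡.cong (N i) (punchIn-swap j≢l l≢j k))) ⟩
    - (sgn l * sgn (punchOut l≢j)) * det (minor (minor N l) (punchOut l≢j))
      ≈⟨ solve 2 (λ s d → :- s :* d := :- (s :* d)) refl _ _ ⟩
    - (sgn l * sgn (punchOut l≢j) * det (minor (minor N l) (punchOut l≢j))) ∎

  -- Expanding twice gives a sum over ordered pairs of distinct columns. The zero diagonal of
  -- `cofactor₂` completes it to a sum over all pairs, so that `det-swap` can exchange the two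
  -- indices.
  det-expand₂ : ∀ {n} a b (N : Matrix Carrier n (suc (suc n))) →
                det (a ∷ b ∷ N) ≈ sum λ j → sum λ l → a j * b l * cofactor₂ N j l
  det-expand₂ a b N = sum-cong-≋ λ j → begin
    sgn j * a j * sum (λ k → sgn k * b (punchIn j k) * det (minor (minor N j) k))
      ≈⟨ *-distribˡ-sum _ (λ k → sgn k * b (punchIn j k) * det (minor (minor N j) k)) ⟩
    sum (λ k → sgn j * a j * (sgn k * b (punchIn j k) * det (minor (minor N j) k)))
      ≈⟨ sum-cong-≋ (λ k → trans
           (solve 5 (λ s a t b d → s :* a :* (t :* b :* d) := a :* b :* (s :* t :* d)) refl
             (sgn j) (a j) (sgn k) (b (punchIn j k)) (det (minor (minor N j) k)))
           (*-congˡ (sym (cofactor₂-punchIn N j k)))) ⟩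
    sum (λ k → a j * b (punchIn j k) * cofactor₂ N j (punchIn j k))
      ≈⟨ +-identityˡ _ ⟨
    0# + sum (λ k → a j * b (punchIn j k) * cofactor₂ N j (punchIn j k))
      ≈⟨ +-congʳ (trans (*-congˡ (cofactor₂-diagonal N j)) (zeroʳ _)) ⟨
    a j * b j * cofactor₂ N j j + sum (λ k → a j * b (punchIn j k) * cofactor₂ N j (punchIn j k))
      ≈⟨ sum-remove {i = j} (λ l → a j * b l * cofactor₂ N j l) ⟨
    sum (λ l → a j * b l * cofactor₂ N j l) ∎

  det-swap : ∀ {n} a b (N : Matrix Carrier n (suc (suc n))) → det (a ∷ b ∷ N) ≈ - 1# * det (b ∷ a ∷ N)
  det-swap a b N = begin
    det (a ∷ b ∷ N)
      ≈⟨ det-expand₂ a b N ⟩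
    sum (λ j → sum λ l → a j * b l * cofactor₂ N j l)
      ≈⟨ ∑-comm (λ j l → a j * b l * cofactor₂ N j l) ⟩
    sum (λ l → sum λ j → a j * b l * cofactor₂ N j l)
      ≈⟨ sum-cong-≋ (λ l → sum-cong-≋ λ j → trans (*-congˡ (cofactor₂-swap N j l))
           (solve 3 (λ a b d → a :* b :* :- d := :- con (+ 1) :* (b :* a :* d)) refl (a j) (b l) (cofactor₂ N l j))) ⟩
    sum (λ l → sum λ j → - 1# * (b l * a j * cofactor₂ N l j))
      ≈⟨ sum-cong-≋ (λ l → *-distribˡ-sum (- 1#) (λ j → b l * a j * cofactor₂ N l j)) ⟨
    sum (λ l → - 1# * sum λ j → b l * a j * cofactor₂ N l j)
      ≈⟨ *-distribˡ-sum (- 1#) (λ l → sum λ j → b l * a j * cofactor₂ N l j) ⟨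
    - 1# * sum (λ l → sum λ j → b l * a j * cofactor₂ N l j)
      ≈⟨ *-congˡ (det-expand₂ b a N) ⟨
    - 1# * det (b ∷ a ∷ N) ∎

  det-linear : ∀ {m n} (x : Vector Carrier m) (a : Matrix Carrier m (suc n)) N →
               det (linearCombination x a ∷ N) ≈ sum λ i → x i * det (a i ∷ N)
  det-linear {m} {n} x a N = begin
    sum (λ j → sgn j * sum (λ i → x i * a i j) * d j)
      ≈⟨ sum-cong-≋ (λ j → trans (*-congʳ (*-distribˡ-sum (sgn j) (λ i → x i * a i j)))
                                 (*-distribʳ-sum (d j) (λ i → sgn j * (x i * a i j)))) ⟩
    sum (λ j → sum λ i → sgn j * (x i * a i j) * d j)
      ≈⟨ ∑-comm (λ j i → sgn j * (x i * a i j) * d j) ⟩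
    sum (λ i → sum λ j → sgn j * (x i * a i j) * d j)
      ≈⟨ sum-cong-≋ (λ i → sum-cong-≋ λ j →
           solve 4 (λ s x a d → s :* (x :* a) :* d := x :* (s :* a :* d)) refl (sgn j) (x i) (a i j) (d j)) ⟩
    sum (λ i → sum λ j → x i * (sgn j * a i j * d j))
      ≈⟨ sum-cong-≋ (λ i → *-distribˡ-sum (x i) (λ j → sgn j * a i j * d j)) ⟨
    sum (λ i → x i * sum λ j → sgn j * a i j * d j) ∎
    where
    d : Fin (suc n) → Carrier
    d j = det (minor N j)

  det-zeroMinors : ∀ {n} (M : Matrix Carrier (suc n) (suc n)) → (∀ j → det (minor (tail M) j) ≈ 0#) → det M ≈ 0#
  det-zeroMinors M minor≈0 = sum-zero λ j → trans (*-congˡ {sgn j * M zero j} (minor≈0 j)) (zeroʳ _)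

  det-zeroRow : ∀ {n} (M : Matrix Carrier (suc n) (suc n)) → (∀ j → M zero j ≈ 0#) → det M ≈ 0#
  det-zeroRow M row≈0 = sum-zero λ j →
    trans (*-congʳ {det (minor (tail M) j)} (trans (*-congˡ {sgn j} (row≈0 j)) (zeroʳ _))) (zeroˡ _)

-- Null vectors, determinants and rank over a domain

record DecidableDomain c ℓ : Set (Level.suc (c ⊔ ℓ)) where
  field
    commutativeRing : CommutativeRing c ℓ
  open CommutativeRing commutativeRing public
  field
    _≈?_     : Decidable _≈_
    integral : ∀ {x y} → x * y ≈ 0# → x ≈ 0# ⊎ y ≈ 0#
    -- This is how the oddness of `p` enters: it separates the eigenvalues 1 and -1 of `σ`, and it
    -- lets a quantity equal to its own negative vanish.
    1+1≉0    : ¬ (1# + 1# ≈ 0#)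

module DomainLinearAlgebra {c ℓ} (D : DecidableDomain c ℓ) where

  open DecidableDomain D hiding (zero)
  open LinearAlgebra commutativeRing
  open IntegerCoefficients commutativeRing
  open FiniteSums commutativeRing
  open Determinant commutativeRing
  open import Relation.Binary.Reasoning.Setoid setoid

  *-cancel-≉0 : ∀ {x y} → ¬ x ≈ 0# → x * y ≈ 0# → y ≈ 0#
  *-cancel-≉0 x≉0 xy≈0 = [ (λ x≈0 → contradiction x≈0 x≉0) , id ]′ (integral xy≈0)

  x+x≈0⇒x≈0 : ∀ {x} → x + x ≈ 0# → x ≈ 0#
  x+x≈0⇒x≈0 {x} x+x≈0 = *-cancel-≉0 1+1≉0
    (trans (solve 1 (λ x → (con (+ 1) :+ con (+ 1)) :* x := x :+ x) refl x) x+x≈0)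

  x≈-x⇒x≈0 : ∀ {x} → x ≈ - x → x ≈ 0#
  x≈-x⇒x≈0 {x} x≈-x = x+x≈0⇒x≈0 (trans (+-congˡ x≈-x) (-‿inverseʳ x))

  1≉0 : ¬ (1# ≈ 0#)
  1≉0 1≈0 = 1+1≉0 (trans (+-cong 1≈0 1≈0) (+-identityˡ 0#))

  Nonzero : ∀ {n} → Vector Carrier n → Set ℓ
  Nonzero x = ∃[ k ] ¬ (x k ≈ 0#)

  ¬Nonzero⇒≈0 : ∀ {n} {x : Vector Carrier n} → ¬ Nonzero x → ∀ k → x k ≈ 0#
  ¬Nonzero⇒≈0 {x = x} ¬nz k = decidable-stable (x k ≈? 0#) λ xk≉0 → ¬nz (k , xk≉0)

  cramer₂ : ∀ {a b c d s t} → ¬ (a * d ≈ b * c) → a * s + b * t ≈ 0# → c * s + d * t ≈ 0# →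
            s ≈ 0# × t ≈ 0#
  cramer₂ {a} {b} {c} {d} {s} {t} ad≉bc p q = cancel ds , cancel dt
    where
    cancel : ∀ {x} → (a * d - b * c) * x ≈ 0# → x ≈ 0#
    cancel = *-cancel-≉0 λ ad-bc≈0 → ad≉bc (x∙y⁻¹≈ε⇒x≈y _ _ ad-bc≈0)
      where
      open import Algebra.Properties.Group +-group using (x∙y⁻¹≈ε⇒x≈y)

    0-0 : ∀ x y → x * 0# - y * 0# ≈ 0#
    0-0 = solve 2 (λ x y → x :* con (+ 0) :- y :* con (+ 0) := con (+ 0)) refl

    ds : (a * d - b * c) * s ≈ 0#
    ds = begin
      (a * d - b * c) * s
        ≈⟨ solve 6 (λ a b c d s t → (a :* d :- b :* c) :* s := d :* (a :* s :+ b :* t) :- b :* (c :* s :+ d :* t)) refl a b c d s t ⟩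
      d * (a * s + b * t) - b * (c * s + d * t)  ≈⟨ +-cong (*-congˡ p) (-‿cong (*-congˡ q)) ⟩
      d * 0# - b * 0#                            ≈⟨ 0-0 d b ⟩
      0#                                         ∎

    dt : (a * d - b * c) * t ≈ 0#
    dt = begin
      (a * d - b * c) * t
        ≈⟨ solve 6 (λ a b c d s t → (a :* d :- b :* c) :* t := a :* (c :* s :+ d :* t) :- c :* (a :* s :+ b :* t)) refl a b c d s t ⟩
      a * (c * s + d * t) - c * (a * s + b * t)  ≈⟨ +-cong (*-congˡ q) (-‿cong (*-congˡ p)) ⟩
      a * 0# - c * 0#                            ≈⟨ 0-0 a c ⟩
      0#                                         ∎

  -- Fraction-free elimination with the pivot p = M i zero.
  wide⇒nontrivialKernel : ∀ {m} (M : Matrix Carrier m (suc m)) → ∃[ x ] Nonzero x × Kernel M x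
  wide⇒nontrivialKernel {zero}  M = (λ _ → 1#) , (zero , 1≉0) , λ ()
  wide⇒nontrivialKernel {suc m} M with any? (λ i → ¬? (M i zero ≈? 0#))
  ... | no noPivot = 1ᴹ zero , (zero , 1≉0) , λ i → begin
    M i ∙ 1ᴹ zero   ≈⟨ ∙-comm (M i) (1ᴹ zero) ⟩
    1ᴹ zero ∙ M i   ≈⟨ 1ᴹ-∙ zero (M i) ⟩
    M i zero        ≈⟨ ¬Nonzero⇒≈0 noPivot i ⟩
    0#              ∎
  ... | yes (i , p≉0) = x , (suc k , λ px′≈0 → x′k≉0 (*-cancel-≉0 p≉0 px′≈0)) , Mx≈0
    where
    p = M i zero

    M′ : Matrix Carrier m (suc m)
    M′ l j = p * M (punchIn i l) (suc j) + - M (punchIn i l) zero * M i (suc j)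

    ih = wide⇒nontrivialKernel M′
    x′ = proj₁ ih
    k = proj₁ (proj₁ (proj₂ ih))
    x′k≉0 = proj₂ (proj₁ (proj₂ ih))
    M′x′≈0 = proj₂ (proj₂ ih)

    q = tail (M i) ∙ x′

    x : Vector Carrier (suc (suc m))
    x = - q ∷ λ j → p * x′ j

    row : ∀ a → a ∙ x ≈ p * (tail a ∙ x′) + - a zero * q
    row a = begin
      a zero * - q + sum (λ j → a (suc j) * (p * x′ j))
        ≈⟨ +-congˡ (sum-cong-≋ λ j → solve 3 (λ a p x → a :* (p :* x) := p :* (a :* x)) refl (a (suc j)) p (x′ j)) ⟩
      a zero * - q + sum (λ j → p * (a (suc j) * x′ j))
        ≈⟨ +-congˡ (*-distribˡ-sum p (λ j → a (suc j) * x′ j)) ⟨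
      a zero * - q + p * (tail a ∙ x′)
        ≈⟨ solve 3 (λ a q r → a :* :- q :+ r := r :+ :- a :* q) refl (a zero) q _ ⟩
      p * (tail a ∙ x′) + - a zero * q ∎

    Mx≈0 : ∀ l → M l ∙ x ≈ 0#
    Mx≈0 l with i ≟ l
    ... | yes ≡.refl = trans (row (M i)) (solve 2 (λ p q → p :* q :+ :- p :* q := con (+ 0)) refl p q)
    ... | no i≢l = ≡.subst (λ l → M l ∙ x ≈ 0#) (punchIn-punchOut i≢l) (begin
      M l′ ∙ x                                  ≈⟨ row (M l′) ⟩
      p * (tail (M l′) ∙ x′) + - M l′ zero * q
        ≈⟨ +-cong (*-congˡ (∙-comm (tail (M l′)) x′)) (*-congˡ (∙-comm (tail (M i)) x′)) ⟩
      p * (x′ ∙ tail (M l′)) + - M l′ zero * (x′ ∙ tail (M i))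
        ≈⟨ ∙-linear x′ p (tail (M l′)) (- M l′ zero) (tail (M i)) ⟨
      x′ ∙ M′ (punchOut i≢l)                    ≈⟨ ∙-comm x′ (M′ (punchOut i≢l)) ⟩
      M′ (punchOut i≢l) ∙ x′                    ≈⟨ M′x′≈0 (punchOut i≢l) ⟩
      0#                                        ∎)
      where l′ = punchIn i (punchOut i≢l)

  -- A left null vector z makes row i redundant whenever z i ≉ 0.
  leftKernel⇒kernel : ∀ {n} (M : Matrix Carrier n n) z → Nonzero z → Kernel (M ᵀ) z →
                      ∃[ x ] Nonzero x × Kernel M x
  leftKernel⇒kernel {suc n} M z (i , zi≉0) zM≈0 = x , x≉0 , Mx≈0
    where
    solution = wide⇒nontrivialKernel (M ∘ punchIn i)
    x = proj₁ solution
    x≉0 = proj₁ (proj₂ solution)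
    M′x≈0 = proj₂ (proj₂ solution)

    others≈0 : ∀ l → l ≢ i → M l ∙ x ≈ 0#
    others≈0 l l≢i = ≡.subst (λ l → M l ∙ x ≈ 0#) (punchIn-punchOut (l≢i ∘ ≡.sym)) (M′x≈0 _)

    Mx≈0 : ∀ l → M l ∙ x ≈ 0#
    Mx≈0 l with l ≟ i
    ... | no l≢i = others≈0 l l≢i
    ... | yes ≡.refl = *-cancel-≉0 zi≉0 (begin
      z i * (M i ∙ x)        ≈⟨ sum-single (λ l → z l * (M l ∙ x)) i (λ l l≢i → trans (*-congˡ (others≈0 l l≢i)) (zeroʳ _)) ⟨
      z ∙ (M *ⱽ x)           ≈⟨ ∙-adjoint z M x ⟩
      (M ᵀ *ⱽ z) ∙ x         ≈⟨ ∙-zeroˡ x zM≈0 ⟩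
      0#                     ∎)

  -- If the equal rows are adjacent at the top, exchanging them negates the determinant. Otherwise
  -- the repeated row is exchanged with the row `N zero` below it; then every minor along the new
  -- first row has a repeated row of smaller index.
  det-repeatedRow : ∀ {n} (N : Matrix Carrier n (suc n)) i → det (N i ∷ N) ≈ 0#
  det-repeatedRow {suc n} N zero = x≈-x⇒x≈0 (begin
    det (N zero ∷ N)                       ≈⟨ det-cong eta ⟩
    det (N zero ∷ N zero ∷ tail N)         ≈⟨ det-swap (N zero) (N zero) (tail N) ⟩
    - 1# * det (N zero ∷ N zero ∷ tail N)  ≈⟨ *-congˡ (det-cong eta) ⟨
    - 1# * det (N zero ∷ N)                ≈⟨ solve 1 (λ d → :- con (+ 1) :* d := :- d) refl _ ⟩
    - det (N zero ∷ N)                     ∎)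
    where
    eta : (N zero ∷ N) ≈ᴹ (N zero ∷ N zero ∷ tail N)
    eta zero          j = refl
    eta (suc zero)    j = refl
    eta (suc (suc i)) j = refl
  det-repeatedRow {suc n} N (suc i) = begin
    det (N (suc i) ∷ N)                       ≈⟨ det-cong eta ⟩
    det (N (suc i) ∷ N zero ∷ tail N)         ≈⟨ det-swap (N (suc i)) (N zero) (tail N) ⟩
    - 1# * det (N zero ∷ N (suc i) ∷ tail N)  ≈⟨ *-congˡ (det-zeroMinors (N zero ∷ N (suc i) ∷ tail N) minor≈0) ⟩
    - 1# * 0#                                 ≈⟨ zeroʳ _ ⟩
    0#                                        ∎
    where
    eta : (N (suc i) ∷ N) ≈ᴹ (N (suc i) ∷ N zero ∷ tail N)
    eta zero          j = refl
    eta (suc zero)    j = refl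
    eta (suc (suc i)) j = refl

    minor≈0 : ∀ j → det (minor (N (suc i) ∷ tail N) j) ≈ 0#
    minor≈0 j = trans
      (det-cong {M = minor (N (suc i) ∷ tail N) j} {minor (tail N) j i ∷ minor (tail N) j} λ { zero k → refl ; (suc l) k → refl })
      (det-repeatedRow (minor (tail N) j) i)

  -- If `u zero` is not 0, replacing the first row by the combination of all rows with coefficients
  -- `u` multiplies the determinant by `u zero`, since the other summands have a repeated row; but
  -- the new row is 0. If `u zero` is 0, the relation passes to the rows of every minor along the
  -- first row.
  leftKernel⇒det≈0 : ∀ {n} (M : Matrix Carrier n n) u → Nonzero u → Kernel (M ᵀ) u → det M ≈ 0#
  leftKernel⇒det≈0 {suc n} M u (k , uk≉0) uM≈0 with u zero ≈? 0#
  ... | yes u₀≈0 = det-zeroMinors M minor≈0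
    where
    tail-nonzero : ∀ k → ¬ u k ≈ 0# → Nonzero (tail u)
    tail-nonzero zero    u₀≉0 = contradiction u₀≈0 u₀≉0
    tail-nonzero (suc k) uk≉0 = k , uk≉0

    minor≈0 : ∀ j → det (minor (tail M) j) ≈ 0#
    minor≈0 j = leftKernel⇒det≈0 (minor (tail M) j) (tail u) (tail-nonzero k uk≉0) λ l → begin
      sum (λ i → M (suc i) (punchIn j l) * u (suc i))  ≈⟨ +-identityˡ _ ⟨
      0# + sum (λ i → M (suc i) (punchIn j l) * u (suc i))
        ≈⟨ +-congʳ (trans (*-congˡ u₀≈0) (zeroʳ _)) ⟨
      (M ᵀ) (punchIn j l) ∙ u                          ≈⟨ uM≈0 (punchIn j l) ⟩
      0#                                               ∎
  ... | no u₀≉0 = *-cancel-≉0 u₀≉0 (begin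
    u zero * det M
      ≈⟨ *-congˡ (det-cong {M = M} {M zero ∷ tail M} λ { zero j → refl ; (suc i) j → refl }) ⟩
    u zero * det (M zero ∷ tail M)
      ≈⟨ sum-single (λ i → u i * det (M i ∷ tail M)) zero (λ
           { zero 0≢0 → contradiction ≡.refl 0≢0
           ; (suc i) _ → trans (*-congˡ (det-repeatedRow (tail M) i)) (zeroʳ _) }) ⟨
    sum (λ i → u i * det (M i ∷ tail M))
      ≈⟨ det-linear u M (tail M) ⟨
    det (linearCombination u M ∷ tail M)
      ≈⟨ det-zeroRow (linearCombination u M ∷ tail M) (λ j → trans (∙-comm u (λ i → M i j)) (uM≈0 j)) ⟩
    0# ∎)

  -- `det` is expanded along a row, so the column relation `x` is first traded for a row relation
  -- `u` of the same square matrix.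
  kernel⇒det≈0 : ∀ {n} (M : Matrix Carrier n n) x → Nonzero x → Kernel M x → det M ≈ 0#
  kernel⇒det≈0 M x x≉0 Mx≈0 with u , u≉0 , uM≈0 ← leftKernel⇒kernel (M ᵀ) x x≉0 Mx≈0 =
    leftKernel⇒det≈0 M u u≉0 uM≈0

  -- If u and v were independent, the r + 2 columns e_i, e_j, b would be independent in dimension r + 1.
  leftKernel-rank1 : ∀ {r n} (M : Matrix Carrier (suc r) n) → HasRank M r →
                     ∀ u v → Kernel (M ᵀ) u → Kernel (M ᵀ) v → ∀ i j → u i * v j ≈ u j * v i
  leftKernel-rank1 {r} M (b , isBasis) u v uM≈0 vM≈0 i j = decidable-stable (_ ≈? _) λ uv≉vu →
    let s≈0 , t≈0 = cramer₂ uv≉vu (relation u uM≈0) (relation v vM≈0)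
    in  proj₂ y≉0 (y≈0 s≈0 t≈0 (proj₁ y≉0))
    where
    open IsBasis isBasis

    N : Matrix Carrier (suc r) (suc (suc r))
    N k = 1ᴹ i k ∷ 1ᴹ j k ∷ λ l → b l k

    solution = wide⇒nontrivialKernel N
    y = proj₁ solution
    y≉0 = proj₁ (proj₂ solution)
    Ny≈0 = proj₂ (proj₂ solution)
    s = y zero
    t = y (suc zero)
    a = tail (tail y)

    b∙ : ∀ u → Kernel (M ᵀ) u → ∀ l → b l ∙ u ≈ 0#
    b∙ u uM≈0 l with x , Mx≈bl ← member l = begin
      b l ∙ u          ≈⟨ ∙-congʳ u Mx≈bl ⟨
      (M *ⱽ x) ∙ u     ≈⟨ ∙-comm (M *ⱽ x) u ⟩
      u ∙ (M *ⱽ x)     ≈⟨ ∙-adjoint u M x ⟩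
      (M ᵀ *ⱽ u) ∙ x   ≈⟨ ∙-zeroˡ x uM≈0 ⟩
      0#               ∎

    relation : ∀ u → Kernel (M ᵀ) u → u i * s + u j * t ≈ 0#
    relation u uM≈0 = begin
      u i * s + u j * t
        ≈⟨ +-congˡ (+-identityʳ _) ⟨
      u i * s + (u j * t + 0#)
        ≈⟨ +-cong (*-congʳ (1ᴹ-∙ i u)) (+-cong (*-congʳ (1ᴹ-∙ j u)) (∙-zeroˡ a (b∙ u uM≈0))) ⟨
      (N ᵀ *ⱽ u) ∙ y   ≈⟨ ∙-adjoint u N y ⟨
      u ∙ (N *ⱽ y)     ≈⟨ ∙-zeroʳ u Ny≈0 ⟩
      0#               ∎

    y≈0 : s ≈ 0# → t ≈ 0# → ∀ k → y k ≈ 0#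
    y≈0 s≈0 t≈0 zero          = s≈0
    y≈0 s≈0 t≈0 (suc zero)    = t≈0
    y≈0 s≈0 t≈0 (suc (suc l)) = independent a (λ k → begin
      sum (λ l → a l * b l k)
        ≈⟨ ∙-comm a (λ l → b l k) ⟩
      (λ l → b l k) ∙ a
        ≈⟨ solve 1 (λ x → con (+ 0) :+ (con (+ 0) :+ x) := x) refl _ ⟨
      0# + (0# + (λ l → b l k) ∙ a)
        ≈⟨ +-cong (trans (*-congˡ s≈0) (zeroʳ _)) (+-congʳ (trans (*-congˡ t≈0) (zeroʳ _))) ⟨
      N k ∙ y
        ≈⟨ Ny≈0 k ⟩
      0# ∎) l

  -- If x and y were independent, they would, together with preimages of b, be r + 2 independent vectors
  -- in dimension r + 1.
  kernel-rank1 : ∀ {m r} (M : Matrix Carrier m (suc r)) → HasRank M r →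
                 ∀ x y → Kernel M x → Kernel M y → ∀ i j → x i * y j ≈ y i * x j
  kernel-rank1 {m} {r} M (b , isBasis) x y Mx≈0 My≈0 i j = decidable-stable (_ ≈? _) λ xy≉yx →
    let s≈0 , t≈0 = cramer₂ xy≉yx (relation i) (relation j)
    in  proj₂ z≉0 (z≈0 s≈0 t≈0 (proj₁ z≉0))
    where
    open IsBasis isBasis

    N : Matrix Carrier (suc r) (suc (suc r))
    N k = x k ∷ y k ∷ λ l → proj₁ (member l) k

    solution = wide⇒nontrivialKernel N
    z = proj₁ solution
    z≉0 = proj₁ (proj₂ solution)
    Nz≈0 = proj₂ (proj₂ solution)
    s = z zero
    t = z (suc zero)
    a = tail (tail z)

    a≈0 : ∀ l → a l ≈ 0#
    a≈0 = independent a λ k → begin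
      sum (λ l → a l * b l k)
        ≈⟨ ∙-comm a (λ l → b l k) ⟩
      (λ l → b l k) ∙ a
        ≈⟨ ∙-congʳ a (λ l → trans (∙-comm (proj₁ (member l)) (M k)) (proj₂ (member l) k)) ⟨
      (λ l → proj₁ (member l) ∙ M k) ∙ a
        ≈⟨ solve 3 (λ x s t → con (+ 0) :* s :+ (con (+ 0) :* t :+ x) := x) refl _ s t ⟨
      0# * s + (0# * t + (λ l → proj₁ (member l) ∙ M k) ∙ a)
        ≈⟨ +-cong (*-congʳ (trans (∙-comm x (M k)) (Mx≈0 k))) (+-congʳ (*-congʳ (trans (∙-comm y (M k)) (My≈0 k)))) ⟨
      (N ᵀ *ⱽ M k) ∙ z
        ≈⟨ ∙-adjoint (M k) N z ⟨
      M k ∙ (N *ⱽ z)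
        ≈⟨ ∙-zeroʳ (M k) Nz≈0 ⟩
      0# ∎

    relation : ∀ k → x k * s + y k * t ≈ 0#
    relation k = begin
      x k * s + y k * t         ≈⟨ +-congˡ (+-identityʳ _) ⟨
      x k * s + (y k * t + 0#)  ≈⟨ +-congˡ (+-congˡ (∙-zeroʳ (tail (tail (N k))) a≈0)) ⟨
      N k ∙ z                   ≈⟨ Nz≈0 k ⟩
      0#                        ∎

    z≈0 : s ≈ 0# → t ≈ 0# → ∀ k → z k ≈ 0#
    z≈0 s≈0 t≈0 zero          = s≈0
    z≈0 s≈0 t≈0 (suc zero)    = t≈0
    z≈0 s≈0 t≈0 (suc (suc l)) = a≈0 l

insertAt-inject₁ : ∀ {a} {A : Set a} {n} (y : Vector A n) x k → insertAt y (fromℕ n) x (inject₁ k) ≡ y k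
insertAt-inject₁ {n = suc n} y x zero    = ≡.refl
insertAt-inject₁ {n = suc n} y x (suc k) = insertAt-inject₁ (tail y) x k

-- Signs, walk vectors and their symmetry under `σ`

module Sign {c ℓ} (R : CommutativeRing c ℓ) where

  open CommutativeRing R hiding (zero)
  open IntegerCoefficients R
  open import Relation.Binary.Reasoning.Setoid setoid

  sign : ℕ → Carrier
  sign zero    = 1#
  sign (suc k) = - sign k

  sign² : ∀ k → sign k * sign k ≈ 1#
  sign² zero    = *-identityˡ 1#
  sign² (suc k) = trans (solve 1 (λ s → :- s :* :- s := s :* s) refl (sign k)) (sign² k)

  sign-+ : ∀ k l → sign (k ℕ.+ l) ≈ sign k * sign l
  sign-+ zero    l = sym (*-identityˡ (sign l))
  sign-+ (suc k) l = begin
    - sign (k ℕ.+ l)      ≈⟨ -‿cong (sign-+ k l) ⟩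
    - (sign k * sign l)   ≈⟨ solve 2 (λ s t → :- (s :* t) := :- s :* t) refl _ _ ⟩
    - sign k * sign l     ∎

  sign-even : ∀ {n} k → n ≡ k ℕ.+ k → sign n ≈ 1#
  sign-even k ≡.refl = trans (sign-+ k k) (sign² k)

-- The vectors w k = Sᵏe are a field, so that one and the same integer vectors serve over ℤ and over ℤ/ p.
record SkewWalk {a ℓ} (D : DecidableDomain a ℓ) (n : ℕ) : Set (a ⊔ ℓ) where
  open DecidableDomain D hiding (zero)
  open LinearAlgebra commutativeRing
  open Sign commutativeRing
  field
    S      : Matrix Carrier n n
    skew   : ∀ i j → S i j ≈ - S j i
    π      : Permutation′ n
    anti   : ∀ i j → S (π ⟨$⟩ʳ i) (π ⟨$⟩ʳ j) ≈ - S i j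
    w      : ℕ → Vector Carrier n
    w-zero : ∀ i → w 0 i ≈ 1#
    w-suc  : ∀ k i → w (suc k) i ≈ (S *ⱽ w k) i

  σ : Fin n → Fin n
  σ = π ⟨$⟩ʳ_

  walk : ∀ m → Matrix Carrier n m
  walk m i k = w (toℕ k) i

  W : Matrix Carrier n n
  W = walk n

  WalkRank : ℕ → Set (a ⊔ ℓ)
  WalkRank r = HasRank W r

  Nonsingular : Set ℓ
  Nonsingular = ¬ (det W ≈ 0#)

  Involutive : Set
  Involutive = ∀ i → σ (σ i) ≡ i

  -- The two cases under which a vector with eigenvalue (-1)ⁿ vanishes at every fixed point and the
  -- sum equation can still be imposed on the other eigenspace. The parity of `n` is recorded as a
  -- value of `sign n`, the form in which it enters computations in the ring.
  FixedPointParity : Set ℓ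
  FixedPointParity = (sign n ≈ 1# × (∀ i → σ i ≢ i)) ⊎ (sign n ≈ - 1# × ∃[ o ] σ o ≡ o)

module AntiSymmetry {a ℓ} {D : DecidableDomain a ℓ} {n : ℕ} (G : SkewWalk D n) where

  open DecidableDomain D hiding (zero)
  open SkewWalk G
  open LinearAlgebra commutativeRing
  open IntegerCoefficients commutativeRing
  open FiniteSums commutativeRing
  open Sign commutativeRing
  open import Relation.Binary.Reasoning.Setoid setoid

  S-∘σ : ∀ v i → (S *ⱽ v) (σ i) ≈ - (S *ⱽ (v ∘ σ)) i
  S-∘σ v i = begin
    sum (λ j → S (σ i) j * v j)           ≈⟨ sum-permute (λ j → S (σ i) j * v j) π ⟩
    sum (λ j → S (σ i) (σ j) * v (σ j))   ≈⟨ ∙-congʳ (v ∘ σ) (anti i) ⟩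
    (λ j → - S i j) ∙ (v ∘ σ)             ≈⟨ neg-∙ (S i) (v ∘ σ) ⟩
    - (S *ⱽ (v ∘ σ)) i                    ∎

  S-skewAdjoint : ∀ u v → u ∙ (S *ⱽ v) ≈ - ((S *ⱽ u) ∙ v)
  S-skewAdjoint u v = begin
    u ∙ (S *ⱽ v)                ≈⟨ ∙-adjoint u S v ⟩
    (S ᵀ *ⱽ u) ∙ v              ≈⟨ ∙-congʳ v (λ j → trans (∙-congʳ u (λ i → skew i j)) (neg-∙ (S j) u)) ⟩
    (λ j → - (S *ⱽ u) j) ∙ v    ≈⟨ neg-∙ (S *ⱽ u) v ⟩
    - ((S *ⱽ u) ∙ v)            ∎

  w-∘σ : ∀ k i → w k (σ i) ≈ sign k * w k i
  w-∘σ zero    i = begin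
    w 0 (σ i)    ≈⟨ w-zero (σ i) ⟩
    1#           ≈⟨ w-zero i ⟨
    w 0 i        ≈⟨ *-identityˡ _ ⟨
    1# * w 0 i   ∎
  w-∘σ (suc k) i = begin
    w (suc k) (σ i)                      ≈⟨ w-suc k (σ i) ⟩
    (S *ⱽ w k) (σ i)                     ≈⟨ S-∘σ (w k) i ⟩
    - (S i ∙ (w k ∘ σ))                  ≈⟨ -‿cong (∙-congˡ (S i) (w-∘σ k)) ⟩
    - (S i ∙ (λ j → sign k * w k j))     ≈⟨ -‿cong (∙-scaleʳ (S i) (sign k) (w k)) ⟩
    - (sign k * (S i ∙ w k))             ≈⟨ solve 2 (λ s x → :- (s :* x) := :- s :* x) refl _ _ ⟩
    - sign k * (S i ∙ w k)               ≈⟨ *-congˡ (w-suc k i) ⟨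
    - sign k * w (suc k) i               ∎

  -- `S` sends every `w k` to `w (suc k)`, so on coefficient vectors it acts as the shift that
  -- prepends 0.
  S-walk : ∀ {m} (y : Vector Carrier m) i → (walk (suc m) *ⱽ (0# ∷ y)) i ≈ (S *ⱽ (walk m *ⱽ y)) i
  S-walk {m} y i = begin
    w 0 i * 0# + sum (λ k → w (suc (toℕ k)) i * y k)
      ≈⟨ solve 2 (λ e x → e :* con (+ 0) :+ x := x) refl (w 0 i) _ ⟩
    sum (λ k → w (suc (toℕ k)) i * y k)
      ≈⟨ sum-cong-≋ (λ k → *-congʳ {y k} (trans (w-suc (toℕ k) i) (∙-comm (S i) (w (toℕ k))))) ⟩
    (walk m ᵀ *ⱽ S i) ∙ y
      ≈⟨ ∙-adjoint (S i) (walk m) y ⟨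
    S i ∙ (walk m *ⱽ y) ∎

  shift-kernel : ∀ {m} (y : Vector Carrier m) → Kernel (walk m) y → Kernel (walk (suc m)) (0# ∷ y)
  shift-kernel y y∈ker i = trans (S-walk y i) (∙-zeroʳ (S i) y∈ker)

  walk-init-last : ∀ {m} (x : Vector Carrier (suc m)) i →
                   (walk (suc m) *ⱽ x) i ≈ (walk m *ⱽ init x) i + w m i * last x
  walk-init-last {m} x i = begin
    (walk (suc m) *ⱽ x) i
      ≈⟨ sum-init-last (λ k → w (toℕ k) i * x k) ⟩
    sum (λ k → w (toℕ (inject₁ k)) i * x (inject₁ k)) + w (toℕ (fromℕ m)) i * last x
      ≡⟨ ≡.cong₂ _+_ (sum-cong-≗ λ k → ≡.cong (λ l → w l i * x (inject₁ k)) (toℕ-inject₁ k))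
                     (≡.cong (λ l → w l i * last x) (toℕ-fromℕ m)) ⟩
    (walk m *ⱽ init x) i + w m i * last x ∎

  pad-kernel : ∀ {m} (y : Vector Carrier m) → Kernel (walk m) y → Kernel (walk (suc m)) (insertAt y (fromℕ m) 0#)
  pad-kernel {m} y y∈ker i = begin
    (walk (suc m) *ⱽ y₀) i
      ≈⟨ walk-init-last y₀ i ⟩
    (walk m *ⱽ init y₀) i + w m i * last y₀
      ≈⟨ +-cong (∙-congˡ (walk m i) (λ k → reflexive (insertAt-inject₁ y 0# k)))
                (*-congˡ (reflexive (insertAt-lookup y (fromℕ m) 0#))) ⟩
    (walk m *ⱽ y) i + w m i * 0#
      ≈⟨ +-cong (y∈ker i) (zeroʳ _) ⟩
    0# + 0#
      ≈⟨ +-identityˡ 0# ⟩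
    0# ∎
    where y₀ = insertAt y (fromℕ m) 0#

  drop-kernel : ∀ {m} (x : Vector Carrier (suc m)) → Kernel (walk (suc m)) x → last x ≈ 0# →
                Kernel (walk m) (init x)
  drop-kernel {m} x x∈ker last≈0 i = begin
    (walk m *ⱽ init x) i                    ≈⟨ +-identityʳ _ ⟨
    (walk m *ⱽ init x) i + 0#               ≈⟨ +-congˡ (trans (*-congˡ last≈0) (zeroʳ _)) ⟨
    (walk m *ⱽ init x) i + w m i * last x   ≈⟨ walk-init-last x i ⟨
    (walk (suc m) *ⱽ x) i                   ≈⟨ x∈ker i ⟩
    0#                                      ∎

  -- Every column of `W` is an eigenvector of `σ`, so composing `v` with `σ` only changes the sign
  -- of its product with that column.
  leftKernel-∘σ : ∀ v → Kernel (W ᵀ) v → Kernel (W ᵀ) (v ∘ σ)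
  leftKernel-∘σ v v∈ker k = begin
    w′ ∙ (v ∘ σ)                                ≈⟨ ∙-congʳ (v ∘ σ) w≈ ⟩
    (λ i → sign (toℕ k) * w′ (σ i)) ∙ (v ∘ σ)   ≈⟨ ∙-comm _ (v ∘ σ) ⟩
    (v ∘ σ) ∙ (λ i → sign (toℕ k) * w′ (σ i))   ≈⟨ ∙-scaleʳ (v ∘ σ) (sign (toℕ k)) (w′ ∘ σ) ⟩
    sign (toℕ k) * ((v ∘ σ) ∙ (w′ ∘ σ))         ≈⟨ *-congˡ (sum-permute (λ i → v i * w′ i) π) ⟨
    sign (toℕ k) * (v ∙ w′)                     ≈⟨ *-congˡ (trans (∙-comm v w′) (v∈ker k)) ⟩
    sign (toℕ k) * 0#                           ≈⟨ zeroʳ _ ⟩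
    0#                                          ∎
    where
    w′ = w (toℕ k)

    w≈ : ∀ i → w′ i ≈ sign (toℕ k) * w′ (σ i)
    w≈ i = begin
      w′ i                                       ≈⟨ *-identityˡ _ ⟨
      1# * w′ i                                  ≈⟨ *-congʳ (sign² (toℕ k)) ⟨
      sign (toℕ k) * sign (toℕ k) * w′ i         ≈⟨ *-assoc _ _ _ ⟩
      sign (toℕ k) * (sign (toℕ k) * w′ i)       ≈⟨ *-congˡ (w-∘σ (toℕ k) i) ⟨
      sign (toℕ k) * w′ (σ i)                    ∎

-- The left kernel of a walk-matrix of corank one

module CorankOne {a ℓ} {D : DecidableDomain a ℓ} {r : ℕ} (G : SkewWalk D (suc r))
  (rank : SkewWalk.WalkRank G r)
  where

  open DecidableDomain D hiding (zero)
  open SkewWalk G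
  open AntiSymmetry G
  open LinearAlgebra commutativeRing
  open IntegerCoefficients commutativeRing
  open FiniteSums commutativeRing
  open DomainLinearAlgebra D
  open Sign commutativeRing
  open import Algebra.Properties.Group +-group using (x∙y⁻¹≈ε⇒x≈y)
  open import Relation.Binary.Reasoning.Setoid setoid

  proportional : ∀ u v → Kernel (W ᵀ) u → Kernel (W ᵀ) v → ∀ i j → u i * v j ≈ u j * v i
  proportional = leftKernel-rank1 W rank

  -- A relation y among w 0, …, w (r - 1) and its shift would be two independent relations among the columns of W.
  walk-independent : ∀ y → Kernel (walk r) y → ∀ k → y k ≈ 0#
  walk-independent y y∈ker k = <-weakInduction (λ j → (0# ∷ y) j ≈ 0#) refl step (suc k)
    where
    -- Proportionality of the padded and the shifted relation, read at two adjacent positions, says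
    -- that the square of `y k` is a multiple of the preceding entry; so vanishing spreads upwards
    -- from the prepended 0.
    step : ∀ k → (0# ∷ y) (inject₁ k) ≈ 0# → y k ≈ 0#
    step k y₋≈0 = [ id , id ]′ (integral (begin
      y k * y k
        ≈⟨ *-congʳ (reflexive (insertAt-inject₁ y 0# k)) ⟨
      insertAt y (fromℕ r) 0# (inject₁ k) * (0# ∷ y) (suc k)
        ≈⟨ kernel-rank1 W rank (insertAt y (fromℕ r) 0#) (0# ∷ y) (pad-kernel y y∈ker) (shift-kernel y y∈ker) (inject₁ k) (suc k) ⟩
      (0# ∷ y) (inject₁ k) * insertAt y (fromℕ r) 0# (suc k)
        ≈⟨ *-congʳ y₋≈0 ⟩
      0# * insertAt y (fromℕ r) 0# (suc k)
        ≈⟨ zeroˡ _ ⟩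
      0# ∎))

  last≈0⇒≈0 : ∀ x → Kernel W x → last x ≈ 0# → ∀ k → x k ≈ 0#
  last≈0⇒≈0 x x∈ker last≈0 k with view k
  ... | ‵fromℕ     = last≈0
  ... | ‵inject₁ k = walk-independent (init x) (drop-kernel x x∈ker last≈0) k

  module _ (v : Vector Carrier (suc r)) (v∈ker : Kernel (W ᵀ) v) where

    leftKernel-init : ∀ (k : Fin r) → w (toℕ k) ∙ v ≈ 0#
    leftKernel-init k = ≡.subst (λ l → w l ∙ v ≈ 0#) (toℕ-inject₁ k) (v∈ker (inject₁ k))

    module _ (v≉0 : Nonzero v) where

      private
        i₀ = proj₁ v≉0
        vi₀≉0 = proj₂ v≉0

      -- Only `k` = `r` goes beyond the columns of `W`. Since `W` is square, `v` yields a right null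
      -- vector `x`, whose last entry cannot be 0. Shifting the relation `x` by `S` thus expresses a
      -- nonzero multiple of `w (suc r)` through `w 1`, ..., `w r`, which are orthogonal to `v`.
      leftKernel-suc : ∀ (k : Fin (suc r)) → w (suc (toℕ k)) ∙ v ≈ 0#
      leftKernel-suc k with view k
      ... | ‵inject₁ k = ≡.subst (λ l → w (suc l) ∙ v ≈ 0#) (≡.sym (toℕ-inject₁ k)) (v∈ker (suc k))
      ... | ‵fromℕ with x , (l , xl≉0) , x∈ker ← leftKernel⇒kernel W v v≉0 v∈ker =
        *-cancel-≉0 (λ last≈0 → xl≉0 (last≈0⇒≈0 x x∈ker last≈0 l)) (begin
          last x * (w (suc (toℕ (fromℕ r))) ∙ v)
            ≈⟨ *-comm _ _ ⟩
          (w (suc (toℕ (fromℕ r))) ∙ v) * last x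
            ≈⟨ sum-single (λ k → (w (suc (toℕ k)) ∙ v) * x k) (fromℕ r) others≈0 ⟨
          sum (λ k → (w (suc (toℕ k)) ∙ v) * x k)
            ≈⟨ solve 2 (λ y x → y :* con (+ 0) :+ x := x) refl (w 0 ∙ v) _ ⟨
          (walk (suc (suc r)) ᵀ *ⱽ v) ∙ (0# ∷ x)
            ≈⟨ ∙-adjoint v (walk (suc (suc r))) (0# ∷ x) ⟨
          v ∙ (walk (suc (suc r)) *ⱽ (0# ∷ x))
            ≈⟨ ∙-zeroʳ v (shift-kernel x x∈ker) ⟩
          0# ∎)
        where
        others≈0 : ∀ k → k ≢ fromℕ r → (w (suc (toℕ k)) ∙ v) * x k ≈ 0#
        others≈0 k k≢r with view k
        ... | ‵fromℕ     = contradiction ≡.refl k≢r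
        ... | ‵inject₁ k = trans
          (*-congʳ (≡.subst (λ l → w (suc l) ∙ v ≈ 0#) (≡.sym (toℕ-inject₁ k)) (v∈ker (suc k)))) (zeroˡ _)

      leftKernel-S : Kernel (W ᵀ) (S *ⱽ v)
      leftKernel-S k = begin
        w (toℕ k) ∙ (S *ⱽ v)       ≈⟨ S-skewAdjoint (w (toℕ k)) v ⟩
        - ((S *ⱽ w (toℕ k)) ∙ v)   ≈⟨ -‿cong (∙-congʳ v (w-suc (toℕ k))) ⟨
        - (w (suc (toℕ k)) ∙ v)    ≈⟨ -‿cong (leftKernel-suc k) ⟩
        - 0#                       ≈⟨ ε⁻¹≈ε ⟩
        0#                         ∎
        where
        open import Algebra.Properties.Group +-group using (ε⁻¹≈ε)

      -- The eigenvalue equation of `v` under `σ`, with the eigenvalue `v (σ i₀)` / `v i₀` cleared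
      -- of its denominator.
      v-∘σ : ∀ k → v i₀ * v (σ k) ≈ v (σ i₀) * v k
      v-∘σ k = trans (proportional v (v ∘ σ) v∈ker (leftKernel-∘σ v v∈ker) i₀ k) (*-comm _ _)

      -- At the preimage of `i₀` under `σ`, the eigenvalue equation makes the square of `v i₀` a
      -- multiple of this entry.
      vσi₀≉0 : ¬ v (σ i₀) ≈ 0#
      vσi₀≉0 vσi₀≈0 = vi₀≉0 (*-cancel-≉0 vi₀≉0 (begin
        v i₀ * v i₀                 ≡⟨ ≡.cong (λ i → v i₀ * v i) (inverseʳ π) ⟨
        v i₀ * v (σ (π ⟨$⟩ˡ i₀))    ≈⟨ v-∘σ (π ⟨$⟩ˡ i₀) ⟩
        v (σ i₀) * v (π ⟨$⟩ˡ i₀)    ≈⟨ *-congʳ vσi₀≈0 ⟩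
        0# * v (π ⟨$⟩ˡ i₀)          ≈⟨ zeroˡ _ ⟩
        0#                          ∎))

      -- v is an eigenvector of S and of σ, and S anticommutes with σ.
      Sv≈0 : ∀ k → (S *ⱽ v) k ≈ 0#
      Sv≈0 k = *-cancel-≉0 vi₀≉0 (begin
        v i₀ * (S *ⱽ v) k    ≈⟨ proportional v (S *ⱽ v) v∈ker leftKernel-S i₀ k ⟩
        v k * (S *ⱽ v) i₀    ≈⟨ *-congˡ (*-cancel-≉0 vσi₀≉0 (x≈-x⇒x≈0 anticommute)) ⟩
        v k * 0#             ≈⟨ zeroʳ _ ⟩
        0#                   ∎)
        where
        anticommute : v (σ i₀) * (S *ⱽ v) i₀ ≈ - (v (σ i₀) * (S *ⱽ v) i₀)
        anticommute = begin
          v (σ i₀) * (S *ⱽ v) i₀               ≈⟨ proportional v (S *ⱽ v) v∈ker leftKernel-S i₀ (σ i₀) ⟨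
          v i₀ * (S *ⱽ v) (σ i₀)               ≈⟨ *-congˡ (S-∘σ v i₀) ⟩
          v i₀ * - (S i₀ ∙ (v ∘ σ))            ≈⟨ solve 2 (λ x y → x :* :- y := :- (x :* y)) refl _ _ ⟩
          - (v i₀ * (S i₀ ∙ (v ∘ σ)))          ≈⟨ -‿cong (∙-scaleʳ (S i₀) (v i₀) (v ∘ σ)) ⟨
          - (S i₀ ∙ (λ k → v i₀ * v (σ k)))    ≈⟨ -‿cong (∙-congˡ (S i₀) v-∘σ) ⟩
          - (S i₀ ∙ (λ k → v (σ i₀) * v k))    ≈⟨ -‿cong (∙-scaleʳ (S i₀) (v (σ i₀)) v) ⟩
          - (v (σ i₀) * (S *ⱽ v) i₀)           ∎

      -- The n vectors v, w 0, …, w (n - 2) are orthogonal to v, hence dependent. Applying S shows that w (n - 2)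
      -- occurs in the relation, so v has the parity of w (n - 2) under σ.
      isotropic⇒parity : v ∙ v ≈ 0# → ∀ k → v (σ k) ≈ sign (suc r) * v k
      isotropic⇒parity v∙v≈0 k = x∙y⁻¹≈ε⇒x≈y _ _ (*-cancel-≉0 vi₀≉0 (begin
        v i₀ * (v (σ k) - sign (suc r) * v k)
          ≈⟨ solve 4 (λ a b s c → a :* (b :- s :* c) := a :* b :- s :* a :* c) refl (v i₀) (v (σ k)) (sign (suc r)) (v k) ⟩
        v i₀ * v (σ k) - sign (suc r) * v i₀ * v k
          ≈⟨ +-cong (v-∘σ k) (-‿cong (*-congʳ ratio)) ⟩
        v (σ i₀) * v k - v (σ i₀) * v k
          ≈⟨ -‿inverseʳ _ ⟩
        0# ∎))
        where
        N : Matrix Carrier (suc r) (suc r)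
        N i = v i ∷ walk r i

        v∈kerN : Kernel (N ᵀ) v
        v∈kerN zero    = v∙v≈0
        v∈kerN (suc k) = leftKernel-init k

        relation = leftKernel⇒kernel N v v≉0 v∈kerN
        y = proj₁ relation
        y≉0 = proj₁ (proj₂ relation)
        Ny≈0 = proj₂ (proj₂ relation)
        α = y zero
        c = tail y

        walk-c : ∀ i → (walk r *ⱽ c) i ≈ - α * v i
        walk-c i = begin
          (walk r *ⱽ c) i             ≈⟨ solve 3 (λ x a v → x := (v :* a :+ x) :+ :- a :* v) refl ((walk r *ⱽ c) i) α (v i) ⟩
          (N i ∙ y) + - α * v i       ≈⟨ +-congʳ (Ny≈0 i) ⟩
          0# + - α * v i              ≈⟨ +-identityˡ _ ⟩
          - α * v i                   ∎

        0∷c∈ker : Kernel W (0# ∷ c)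
        0∷c∈ker i = begin
          (W *ⱽ (0# ∷ c)) i           ≈⟨ S-walk c i ⟩
          S i ∙ (walk r *ⱽ c)         ≈⟨ ∙-congˡ (S i) walk-c ⟩
          S i ∙ (λ l → - α * v l)     ≈⟨ ∙-scaleʳ (S i) (- α) v ⟩
          - α * (S *ⱽ v) i            ≈⟨ *-congˡ (Sv≈0 i) ⟩
          - α * 0#                    ≈⟨ zeroʳ _ ⟩
          0#                          ∎

        last≉0 : ¬ (last (0# ∷ c) ≈ 0#)
        last≉0 last≈0 = proj₂ y≉0 (y≈0 (proj₁ y≉0))
          where
          c≈0 : ∀ k → c k ≈ 0#
          c≈0 k = last≈0⇒≈0 (0# ∷ c) 0∷c∈ker last≈0 (suc k)

          y≈0 : ∀ k → y k ≈ 0#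
          y≈0 (suc k) = c≈0 k
          y≈0 zero    = *-cancel-≉0 vi₀≉0 (begin
            v i₀ * α                        ≈⟨ +-identityʳ _ ⟨
            v i₀ * α + 0#                   ≈⟨ +-congˡ (∙-zeroʳ (walk r i₀) c≈0) ⟨
            N i₀ ∙ y                        ≈⟨ Ny≈0 i₀ ⟩
            0#                              ∎)

        -- Composing the relation with `σ` multiplies the coefficient of `w k` by `sign k` and
        -- multiplies `v` by its eigenvalue. This combination of the old and the new relation
        -- cancels `v` and leaves a relation among the walk vectors alone.
        c′ : Vector Carrier r
        c′ k = v i₀ * (sign (toℕ k) * c k) + - v (σ i₀) * c k

        c′∈ker : Kernel (walk r) c′
        c′∈ker i = begin
          walk r i ∙ c′
            ≈⟨ ∙-linear (walk r i) (v i₀) (λ k → sign (toℕ k) * c k) (- v (σ i₀)) c ⟩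
          v i₀ * (walk r i ∙ (λ k → sign (toℕ k) * c k)) + - v (σ i₀) * (walk r i ∙ c)
            ≈⟨ +-congʳ (*-congˡ (sum-cong-≋ λ k → trans
                 (solve 3 (λ w s c → w :* (s :* c) := (s :* w) :* c) refl (w (toℕ k) i) (sign (toℕ k)) (c k))
                 (*-congʳ {c k} (sym (w-∘σ (toℕ k) i))))) ⟩
          v i₀ * (walk r (σ i) ∙ c) + - v (σ i₀) * (walk r i ∙ c)
            ≈⟨ +-cong (*-congˡ (walk-c (σ i))) (*-congˡ (walk-c i)) ⟩
          v i₀ * (- α * v (σ i)) + - v (σ i₀) * (- α * v i)
            ≈⟨ solve 5 (λ a b c d α → a :* (:- α :* b) :+ :- c :* (:- α :* d) := :- α :* (a :* b :- c :* d)) refl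
                 (v i₀) (v (σ i)) (v (σ i₀)) (v i) α ⟩
          - α * (v i₀ * v (σ i) - v (σ i₀) * v i)
            ≈⟨ *-congˡ (trans (+-congʳ (v-∘σ i)) (-‿inverseʳ _)) ⟩
          - α * 0#
            ≈⟨ zeroʳ _ ⟩
          0# ∎

        -- Indexing by `0# ∷ c` instead of `c` covers `r` = 0 as well: there the last entry is the
        -- prepended 0, which `last≉0` excludes. Position `suc k` holds the coefficient of `w k`,
        -- hence the extra minus sign.
        ratio′ : ∀ k → ¬ ((0# ∷ c) k ≈ 0#) → - sign (toℕ k) * v i₀ ≈ v (σ i₀)
        ratio′ zero    0≉0  = contradiction refl 0≉0
        ratio′ (suc k) ck≉0 = x∙y⁻¹≈ε⇒x≈y _ _ (*-cancel-≉0 ck≉0 (begin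
          c k * (- - sign (toℕ k) * v i₀ - v (σ i₀))
            ≈⟨ solve 4 (λ c s a b → c :* (:- (:- s) :* a :- b) := a :* (s :* c) :+ :- b :* c) refl (c k) (sign (toℕ k)) (v i₀) (v (σ i₀)) ⟩
          c′ k
            ≈⟨ walk-independent c′ c′∈ker k ⟩
          0# ∎))

        ratio : sign (suc r) * v i₀ ≈ v (σ i₀)
        ratio = ≡.subst (λ l → - sign l * v i₀ ≈ v (σ i₀)) (toℕ-fromℕ r) (ratio′ (fromℕ r) last≉0)

-- An involution and its two eigenspaces

module Involution {a ℓ} (D : DecidableDomain a ℓ) {n : ℕ} (π : Permutation′ n)
  (involutive : ∀ i → π ⟨$⟩ʳ (π ⟨$⟩ʳ i) ≡ i)
  where

  open DecidableDomain D hiding (zero)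
  open LinearAlgebra commutativeRing
  open IntegerCoefficients commutativeRing
  open FiniteSums commutativeRing
  open DomainLinearAlgebra D
  open import Algebra.Properties.Group +-group using (⁻¹-involutive; ε⁻¹≈ε)
  open import Relation.Binary.Reasoning.Setoid setoid

  private
    σ : Fin n → Fin n
    σ = π ⟨$⟩ʳ_

  -- Multiplication by δ exchanges the two eigenspaces of σ, up to the fixed points.
  δ : Fin n → Carrier
  δ i with <-cmp i (σ i)
  ... | tri< _ _ _ = 1#
  ... | tri≈ _ _ _ = 0#
  ... | tri> _ _ _ = - 1#

  δ-∘σ : ∀ i → δ (σ i) ≈ - δ i
  δ-∘σ i with <-cmp i (σ i) | <-cmp (σ i) (σ (σ i))
  ... | tri< _ _ _     | tri> _ _ _      = refl
  ... | tri≈ _ _ _     | tri≈ _ _ _      = sym ε⁻¹≈ε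
  ... | tri> _ _ _     | tri< _ _ _      = sym (⁻¹-involutive 1#)
  ... | tri< _ _ ¬gt   | tri< lt _ _     = contradiction (≡.subst (σ i <_) (involutive i) lt) ¬gt
  ... | tri< _ ¬eq _   | tri≈ _ eq _     = contradiction (≡.sym (≡.trans eq (involutive i))) ¬eq
  ... | tri≈ _ eq _    | tri< _ ¬eq _    = contradiction (≡.cong σ eq) ¬eq
  ... | tri≈ _ eq _    | tri> _ ¬eq _    = contradiction (≡.cong σ eq) ¬eq
  ... | tri> ¬lt _ _   | tri> _ _ gt     = contradiction (≡.subst (_< σ i) (involutive i) gt) ¬lt
  ... | tri> _ ¬eq _   | tri≈ _ eq _     = contradiction (≡.sym (≡.trans eq (involutive i))) ¬eq

  δ-fixed : ∀ {i} → σ i ≡ i → δ i ≈ 0#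
  δ-fixed {i} σi≡i with <-cmp i (σ i)
  ... | tri< _ ¬eq _ = contradiction (≡.sym σi≡i) ¬eq
  ... | tri≈ _ _ _   = refl
  ... | tri> _ ¬eq _ = contradiction (≡.sym σi≡i) ¬eq

  δ²-moved : ∀ {i} → σ i ≢ i → δ i * δ i ≈ 1#
  δ²-moved {i} σi≢i with <-cmp i (σ i)
  ... | tri< _ _ _  = *-identityˡ 1#
  ... | tri≈ _ eq _ = contradiction (≡.sym eq) σi≢i
  ... | tri> _ _ _  = solve 0 (:- con (+ 1) :* :- con (+ 1) := con (+ 1)) refl

  ∙-∘σ : ∀ (u v : Vector Carrier n) → (u ∘ σ) ∙ v ≈ u ∙ (v ∘ σ)
  ∙-∘σ u v = begin
    sum (λ i → u (σ i) * v i)             ≈⟨ sum-permute (λ i → u (σ i) * v i) π ⟩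
    sum (λ i → u (σ (σ i)) * v (σ i))     ≡⟨ sum-cong-≗ (λ i → ≡.cong (λ j → u j * v (σ i)) (involutive i)) ⟩
    sum (λ i → u i * v (σ i))             ∎

  1ᴹ-∘σ : ∀ {o} → σ o ≡ o → ∀ i → 1ᴹ o (σ i) ≈ 1ᴹ o i
  1ᴹ-∘σ {o} σo≡o i with i ≟ o
  ... | yes ≡.refl = reflexive (≡.cong (1ᴹ o) σo≡o)
  ... | no i≢o     = trans (1ᴹ-offDiagonal o≢σi) (sym (1ᴹ-offDiagonal (i≢o ∘ ≡.sym)))
    where
    o≢σi : o ≢ σ i
    o≢σi o≡σi = i≢o (≡.trans (≡.sym (involutive i)) (≡.trans (≡.cong σ (≡.sym o≡σi)) σo≡o))

  -- Passing from `i` to `σ i` negates `A` and preserves the other two terms, so comparing the two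
  -- equations isolates `A`. At `o` the factor `δ` is 0 and only `c` is left. Where `σ` moves `i`,
  -- `δ` squares to 1 and `B` is recovered; at fixed points `B` equals its own negative.
  oddPart-split : ∀ {o} → σ o ≡ o → ∀ c (A B : Vector Carrier n) → (∀ i → A (σ i) ≈ - A i) → (∀ i → B (σ i) ≈ - B i) →
                  (∀ i → 1ᴹ o i * c + (A i + δ i * B i) ≈ 0#) →
                  c ≈ 0# × (∀ i → A i ≈ 0#) × (∀ i → B i ≈ 0#)
  oddPart-split {o} σo≡o c A B A-∘σ B-∘σ equation = c≈0 , A≈0 , B≈0
    where
    equation-∘σ : ∀ i → 1ᴹ o i * c + (- A i + δ i * B i) ≈ 0#
    equation-∘σ i = begin
      1ᴹ o i * c + (- A i + δ i * B i)
        ≈⟨ +-congˡ (+-congˡ (solve 2 (λ d b → d :* b := :- d :* :- b) refl (δ i) (B i))) ⟩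
      1ᴹ o i * c + (- A i + - δ i * - B i)
        ≈⟨ +-cong (*-congʳ (1ᴹ-∘σ σo≡o i)) (+-cong (A-∘σ i) (*-cong (δ-∘σ i) (B-∘σ i))) ⟨
      1ᴹ o (σ i) * c + (A (σ i) + δ (σ i) * B (σ i))
        ≈⟨ equation (σ i) ⟩
      0# ∎

    A≈0 : ∀ i → A i ≈ 0#
    A≈0 i = x+x≈0⇒x≈0 (begin
      A i + A i
        ≈⟨ solve 3 (λ a b c → b :+ b := (a :+ (b :+ c)) :- (a :+ (:- b :+ c))) refl (1ᴹ o i * c) (A i) (δ i * B i) ⟩
      1ᴹ o i * c + (A i + δ i * B i) - (1ᴹ o i * c + (- A i + δ i * B i))
        ≈⟨ +-cong (equation i) (-‿cong (equation-∘σ i)) ⟩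
      0# - 0#
        ≈⟨ -‿inverseʳ 0# ⟩
      0# ∎)

    c≈0 : c ≈ 0#
    c≈0 = begin
      c
        ≈⟨ solve 2 (λ y b → y := con (+ 1) :* y :+ (con (+ 0) :+ con (+ 0) :* b)) refl c (B o) ⟩
      1# * c + (0# + 0# * B o)
        ≈⟨ +-cong (*-congʳ (1ᴹ-diagonal o)) (+-cong (A≈0 o) (*-congʳ (δ-fixed σo≡o))) ⟨
      1ᴹ o o * c + (A o + δ o * B o)
        ≈⟨ equation o ⟩
      0# ∎

    B≈0′ : ∀ i → Dec (σ i ≡ i) → B i ≈ 0#
    B≈0′ i (yes σi≡i) = x≈-x⇒x≈0 (trans (reflexive (≡.cong B (≡.sym σi≡i))) (B-∘σ i))
    B≈0′ i (no σi≢i) = begin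
      B i
        ≈⟨ *-identityˡ _ ⟨
      1# * B i
        ≈⟨ *-congʳ (δ²-moved σi≢i) ⟨
      δ i * δ i * B i
        ≈⟨ solve 3 (λ d b o → d :* d :* b := d :* (o :* con (+ 0) :+ (con (+ 0) :+ d :* b))) refl (δ i) (B i) (1ᴹ o i) ⟩
      δ i * (1ᴹ o i * 0# + (0# + δ i * B i))
        ≈⟨ *-congˡ (+-cong (*-congˡ c≈0) (+-congʳ (A≈0 i))) ⟨
      δ i * (1ᴹ o i * c + (A i + δ i * B i))
        ≈⟨ *-congˡ (equation i) ⟩
      δ i * 0#
        ≈⟨ zeroʳ _ ⟩
      0# ∎

    B≈0 : ∀ i → B i ≈ 0#
    B≈0 i = B≈0′ i (σ i ≟ i)

-- Consequences of a nonsingular walk-matrix for the permutation `σ`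

module NonsingularWalkMatrix {a ℓ} {D : DecidableDomain a ℓ} {m : ℕ} (G : SkewWalk D (suc m))
  (det≉0 : SkewWalk.Nonsingular G)
  where

  open DecidableDomain D hiding (zero)
  open SkewWalk G
  open AntiSymmetry G
  open LinearAlgebra commutativeRing
  open IntegerCoefficients commutativeRing
  open FiniteSums commutativeRing
  open DomainLinearAlgebra D
  open Sign commutativeRing
  open import Relation.Binary.Reasoning.Setoid setoid

  leftKernel≈0 : ∀ u → Kernel (W ᵀ) u → ∀ k → u k ≈ 0#
  leftKernel≈0 u u∈ker = ¬Nonzero⇒≈0 λ u≉0 → det≉0 (leftKernel⇒det≈0 W u u≉0 u∈ker)

  kernel≈0 : ∀ x → Kernel W x → ∀ k → x k ≈ 0#
  kernel≈0 x x∈ker = ¬Nonzero⇒≈0 λ x≉0 → det≉0 (kernel⇒det≈0 W x x≉0 x∈ker)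

  -- Rows i and σ (σ i) of W agree.
  σ-involutive : ∀ i → σ (σ i) ≡ i
  σ-involutive i = decidable-stable (σ (σ i) ≟ i) λ σσi≢i → 1≉0 (begin
    1#                                     ≈⟨ solve 0 (con (+ 1) := :- (con (+ 1) :* con (+ 0) :+ :- con (+ 1) :* con (+ 1))) refl ⟩
    - (1# * 0# + - 1# * 1#)                ≈⟨ -‿cong (+-cong (*-congˡ (1ᴹ-offDiagonal σσi≢i)) (*-congˡ (1ᴹ-diagonal i))) ⟨
    - u i                                  ≈⟨ -‿cong (leftKernel≈0 u u∈ker i) ⟩
    - 0#                                   ≈⟨ solve 0 (:- con (+ 0) := con (+ 0)) refl ⟩
    0#                                     ∎)
    where
    u : Vector Carrier (suc m)
    u j = 1# * 1ᴹ (σ (σ i)) j + - 1# * 1ᴹ i j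

    u∈ker : Kernel (W ᵀ) u
    u∈ker k = begin
      w′ ∙ u
        ≈⟨ ∙-linear w′ 1# (1ᴹ (σ (σ i))) (- 1#) (1ᴹ i) ⟩
      1# * (w′ ∙ 1ᴹ (σ (σ i))) + - 1# * (w′ ∙ 1ᴹ i)
        ≈⟨ +-cong (*-congˡ (trans (∙-comm w′ (1ᴹ (σ (σ i)))) (1ᴹ-∙ (σ (σ i)) w′)))
                  (*-congˡ (trans (∙-comm w′ (1ᴹ i)) (1ᴹ-∙ i w′))) ⟩
      1# * w′ (σ (σ i)) + - 1# * w′ i
        ≈⟨ +-congʳ (*-congˡ (trans (w-∘σ (toℕ k) (σ i)) (*-congˡ (w-∘σ (toℕ k) i)))) ⟩
      1# * (s * (s * w′ i)) + - 1# * w′ i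
        ≈⟨ solve 2 (λ s x → con (+ 1) :* (s :* (s :* x)) :+ :- con (+ 1) :* x := (s :* s :- con (+ 1)) :* x) refl s (w′ i) ⟩
      (s * s - 1#) * w′ i
        ≈⟨ *-congʳ (trans (+-congʳ (sign² (toℕ k))) (-‿inverseʳ 1#)) ⟩
      0# * w′ i
        ≈⟨ zeroˡ _ ⟩
      0# ∎
      where
      w′ = w (toℕ k)
      s = sign (toℕ k)

  open Involution D π σ-involutive

  module _ (even : sign (suc m) ≈ 1#) (o : Fin (suc m)) (σo≡o : σ o ≡ o) where

    -- Each takes the value 2 on the indices of one parity and 0 on the others, and so selects
    -- columns inside a sum without a case distinction.
    odd# even# : ℕ → Carrier
    odd#  k = 1# - sign k
    even# k = 1# + sign k

    N : Matrix Carrier (suc m) (suc (suc m))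
    N i = 1ᴹ o i ∷ λ k → odd# (toℕ k) * w (toℕ k) i + δ i * (even# (toℕ k) * w (suc (toℕ k)) i)

    kernelN≈0 : ∀ y → Kernel N y → ∀ k → y k ≈ 0#
    kernelN≈0 y Ny≈0 = y≈0
      where
      x = tail y

      A B : Vector Carrier (suc m)
      A i = sum λ k → odd# (toℕ k) * w (toℕ k) i * x k
      B i = sum λ k → even# (toℕ k) * w (suc (toℕ k)) i * x k

      equation : ∀ i → 1ᴹ o i * y zero + (A i + δ i * B i) ≈ 0#
      equation i = begin
        1ᴹ o i * y zero + (A i + δ i * B i)
          ≈⟨ +-congˡ (+-congˡ (*-distribˡ-sum (δ i) (λ k → even# (toℕ k) * w (suc (toℕ k)) i * x k))) ⟩
        1ᴹ o i * y zero + (A i + sum (λ k → δ i * (even# (toℕ k) * w (suc (toℕ k)) i * x k)))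
          ≈⟨ +-congˡ (∑-distrib-+ (λ k → odd# (toℕ k) * w (toℕ k) i * x k) (λ k → δ i * (even# (toℕ k) * w (suc (toℕ k)) i * x k))) ⟨
        1ᴹ o i * y zero + sum (λ k → odd# (toℕ k) * w (toℕ k) i * x k + δ i * (even# (toℕ k) * w (suc (toℕ k)) i * x k))
          ≈⟨ +-congˡ (sum-cong-≋ λ k → solve 4 (λ p d q x → p :* x :+ d :* (q :* x) := (p :+ d :* q) :* x) refl
               (odd# (toℕ k) * w (toℕ k) i) (δ i) (even# (toℕ k) * w (suc (toℕ k)) i) (x k)) ⟩
        N i ∙ y
          ≈⟨ Ny≈0 i ⟩
        0# ∎

      negate : ∀ (f g : Vector Carrier (suc m)) → (∀ k → f k ≈ - g k) → sum f ≈ - sum g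
      negate f g f≈-g = begin
        sum f                      ≈⟨ sum-cong-≋ (λ k → trans (f≈-g k) (solve 1 (λ g → :- g := :- g :* con (+ 1)) refl (g k))) ⟩
        (λ k → - g k) ∙ (λ _ → 1#) ≈⟨ neg-∙ g (λ _ → 1#) ⟩
        - (g ∙ (λ _ → 1#))         ≈⟨ -‿cong (sum-cong-≋ λ k → *-identityʳ (g k)) ⟩
        - sum g                    ∎

      A-∘σ : ∀ i → A (σ i) ≈ - A i
      A-∘σ i = negate (λ k → odd# (toℕ k) * w (toℕ k) (σ i) * x k) (λ k → odd# (toℕ k) * w (toℕ k) i * x k) λ k →
        let s = sign (toℕ k); w′ = w (toℕ k) i in begin
        (1# - s) * w (toℕ k) (σ i) * x k   ≈⟨ *-congʳ (*-congˡ (w-∘σ (toℕ k) i)) ⟩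
        (1# - s) * (s * w′) * x k
          ≈⟨ solve 3 (λ s w x → (con (+ 1) :- s) :* (s :* w) :* x := (s :- s :* s) :* (w :* x)) refl s w′ (x k) ⟩
        (s - s * s) * (w′ * x k)           ≈⟨ *-congʳ (+-congˡ (-‿cong (sign² (toℕ k)))) ⟩
        (s - 1#) * (w′ * x k)
          ≈⟨ solve 3 (λ s w x → (s :- con (+ 1)) :* (w :* x) := :- ((con (+ 1) :- s) :* w :* x)) refl s w′ (x k) ⟩
        - ((1# - s) * w′ * x k)            ∎

      B-∘σ : ∀ i → B (σ i) ≈ - B i
      B-∘σ i = negate (λ k → even# (toℕ k) * w (suc (toℕ k)) (σ i) * x k) (λ k → even# (toℕ k) * w (suc (toℕ k)) i * x k) λ k →
        let s = sign (toℕ k); w′ = w (suc (toℕ k)) i in begin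
        (1# + s) * w (suc (toℕ k)) (σ i) * x k   ≈⟨ *-congʳ (*-congˡ (w-∘σ (suc (toℕ k)) i)) ⟩
        (1# + s) * (- s * w′) * x k
          ≈⟨ solve 3 (λ s w x → (con (+ 1) :+ s) :* (:- s :* w) :* x := :- ((s :+ s :* s) :* (w :* x))) refl s w′ (x k) ⟩
        - ((s + s * s) * (w′ * x k))             ≈⟨ -‿cong (*-congʳ (+-congˡ (sign² (toℕ k)))) ⟩
        - ((s + 1#) * (w′ * x k))
          ≈⟨ solve 3 (λ s w x → :- ((s :+ con (+ 1)) :* (w :* x)) := :- ((con (+ 1) :+ s) :* w :* x)) refl s w′ (x k) ⟩
        - ((1# + s) * w′ * x k)                  ∎

      split = oddPart-split σo≡o (y zero) A B A-∘σ B-∘σ equation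
      y₀≈0 = proj₁ split
      A≈0 = proj₁ (proj₂ split)
      B≈0 = proj₂ (proj₂ split)

      odd#x≈0 : ∀ k → odd# (toℕ k) * x k ≈ 0#
      odd#x≈0 = kernel≈0 (λ k → odd# (toℕ k) * x k) λ i → trans
        (sum-cong-≋ λ k → solve 3 (λ w s x → w :* (s :* x) := s :* w :* x) refl (w (toℕ k) i) (odd# (toℕ k)) (x k))
        (A≈0 i)

      even#x : Vector Carrier (suc m)
      even#x k = even# (toℕ k) * x k

      -- Since `suc m` is even, `m` is odd and its selector `even#` is 0. This removes the only term
      -- with `w (suc m)`, which is not a column of `W`.
      last≈0 : last even#x ≈ 0#
      last≈0 = begin
        even# (toℕ (fromℕ m)) * last x   ≡⟨ ≡.cong (λ k → even# k * last x) (toℕ-fromℕ m) ⟩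
        (1# + sign m) * last x           ≈⟨ *-congʳ (+-congʳ even) ⟨
        (- sign m + sign m) * last x     ≈⟨ *-congʳ (-‿inverseˡ _) ⟩
        0# * last x                      ≈⟨ zeroˡ _ ⟩
        0#                               ∎

      shifted∈ker : Kernel W (0# ∷ init even#x)
      shifted∈ker i = begin
        w 0 i * 0# + sum (λ k → w (suc (toℕ k)) i * init even#x k)
          ≈⟨ +-congʳ (zeroʳ _) ⟩
        0# + sum (λ k → w (suc (toℕ k)) i * init even#x k)
          ≈⟨ +-identityˡ _ ⟩
        sum (λ k → w (suc (toℕ k)) i * init even#x k)
          ≡⟨ sum-cong-≗ (λ k → ≡.cong (λ l → w (suc l) i * init even#x k) (toℕ-inject₁ k)) ⟨
        sum (λ k → w (suc (toℕ (inject₁ k))) i * init even#x k)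
          ≈⟨ +-identityʳ _ ⟨
        sum (λ k → w (suc (toℕ (inject₁ k))) i * init even#x k) + 0#
          ≈⟨ +-congˡ (trans (*-congˡ last≈0) (zeroʳ _)) ⟨
        sum (λ k → w (suc (toℕ (inject₁ k))) i * init even#x k) + w (suc (toℕ (fromℕ m))) i * last even#x
          ≈⟨ sum-init-last (λ k → w (suc (toℕ k)) i * even#x k) ⟨
        sum (λ k → w (suc (toℕ k)) i * even#x k)
          ≈⟨ sum-cong-≋ (λ k → solve 3 (λ w s x → w :* (s :* x) := s :* w :* x) refl (w (suc (toℕ k)) i) (even# (toℕ k)) (x k)) ⟩
        B i
          ≈⟨ B≈0 i ⟩
        0# ∎

      even#x≈0′ : ∀ {k} → View k → even#x k ≈ 0#
      even#x≈0′ ‵fromℕ       = last≈0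
      even#x≈0′ (‵inject₁ k) = kernel≈0 (0# ∷ init even#x) shifted∈ker (suc k)

      even#x≈0 : ∀ k → even#x k ≈ 0#
      even#x≈0 k = even#x≈0′ (view k)

      y≈0 : ∀ k → y k ≈ 0#
      y≈0 zero    = y₀≈0
      y≈0 (suc k) = x+x≈0⇒x≈0 (begin
        x k + x k
          ≈⟨ solve 2 (λ s x → x :+ x := (con (+ 1) :- s) :* x :+ (con (+ 1) :+ s) :* x) refl (sign (toℕ k)) (x k) ⟩
        odd# (toℕ k) * x k + even# (toℕ k) * x k
          ≈⟨ +-cong (odd#x≈0 k) (even#x≈0 k) ⟩
        0# + 0#
          ≈⟨ +-identityˡ 0# ⟩
        0# ∎)

  -- Otherwise the columns w k (k odd), δ w (k + 1) (k even) and e_o would be n + 1 independent vectors.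
  even⇒noFixedPoint : sign (suc m) ≈ 1# → ∀ o → σ o ≢ o
  even⇒noFixedPoint even o σo≡o =
    let y , (k , yk≉0) , y∈ker = wide⇒nontrivialKernel (N even o σo≡o)
    in  yk≉0 (kernelN≈0 even o σo≡o y y∈ker k)

-- An isotropic left null vector forces one of opposite parity

module IsotropicKernel {a ℓ} {D : DecidableDomain a ℓ} {r : ℕ} (G : SkewWalk D (suc r))
  (rank : SkewWalk.WalkRank G r) (involutive : SkewWalk.Involutive G) (parity : SkewWalk.FixedPointParity G)
  where

  open DecidableDomain D hiding (zero)
  open SkewWalk G
  open AntiSymmetry G
  open LinearAlgebra commutativeRing
  open Sign commutativeRing
  open IntegerCoefficients commutativeRing
  open FiniteSums commutativeRing
  open DomainLinearAlgebra D
  open CorankOne G rank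
  open Involution D π involutive
  open import Relation.Binary.Reasoning.Setoid setoid

  ε = sign (suc r)

  ε² : ε * ε ≈ 1#
  ε² = sign² (suc r)

  -- For even `n` there is no fixed point, and for odd `n` the factor `ε` is -1. It shows that
  -- vectors in the `ε`-eigenspace vanish at fixed points.
  fixed⇒≈0 : ∀ {i x} → σ i ≡ i → x ≈ ε * x → x ≈ 0#
  fixed⇒≈0 {i} {x} σi≡i x≈εx = [ (λ (_ , σi≢i) → contradiction σi≡i (σi≢i i)) , (λ (ε≈-1 , _) → x≈-x⇒x≈0 (begin
    x          ≈⟨ x≈εx ⟩
    ε * x      ≈⟨ *-congʳ ε≈-1 ⟩
    - 1# * x   ≈⟨ solve 1 (λ x → :- con (+ 1) :* x := :- x) refl x ⟩
    - x        ∎)) ]′ parity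

  -- 1# on the fixed points of σ and 0# elsewhere
  φ : Vector Carrier (suc r)
  φ i = 1# - δ i * δ i

  φδ≈0 : ∀ i → φ i * δ i ≈ 0#
  φδ≈0 i with σ i ≟ i
  ... | yes σi≡i = trans (*-congˡ (δ-fixed σi≡i)) (zeroʳ _)
  ... | no σi≢i  = trans (*-congʳ (trans (+-congˡ (-‿cong (δ²-moved σi≢i))) (-‿inverseʳ 1#))) (zeroˡ _)

  φ-∘σ : ∀ i → φ (σ i) ≈ φ i
  φ-∘σ i = +-congˡ (-‿cong (trans (*-cong (δ-∘σ i) (δ-∘σ i)) (solve 1 (λ d → :- d :* :- d := d :* d) refl (δ i))))

  -- At a moved index the row is the equation (`S u`) i = 0 up to sign. At a fixed index that
  -- equation holds by itself for `u` in the (-`ε`)-eigenspace, and the vacant row carries eᵀu = 0.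
  -- The factor `δ` brings the image of `S` back, so that `A` maps this eigenspace into itself.
  A : Matrix Carrier (suc r) (suc r)
  A i j = δ i * S i j + φ i * 1#

  -- The first summand acts as 2 A on the (-ε)-eigenspace of σ, the second as 2 on the ε-eigenspace.
  M : Matrix Carrier (suc r) (suc r)
  M i j = 1# * (1# * A i j + - ε * A i (σ j)) + 1# * (1# * 1ᴹ i j + ε * 1ᴹ i (σ j))

  module RightKernel (u : Vector Carrier (suc r)) (u∈ker : Kernel M u) where

    u⁺ u⁻ X : Vector Carrier (suc r)
    u⁺ k = u k + ε * u (σ k)
    u⁻ k = 1# * u k + - ε * u (σ k)
    X = S *ⱽ u⁻

    s : Carrier
    s = u⁻ ∙ (λ _ → 1#)

    ∙-∘σ′ : ∀ a → u ∙ (a ∘ σ) ≈ a ∙ (u ∘ σ)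
    ∙-∘σ′ a = trans (∙-comm u (a ∘ σ)) (∙-∘σ a u)

    -- Moving `σ` from the columns of `M` to `u` turns `M u` into `A u⁻` + `u⁺`. These summands lie
    -- in different eigenspaces of `σ` and can therefore be separated.
    equation : ∀ i → (δ i * X i + φ i * s) + u⁺ i ≈ 0#
    equation i = begin
      (δ i * X i + φ i * s) + u⁺ i
        ≈⟨ +-congʳ (+-congʳ (*-congˡ (∙-comm (S i) u⁻))) ⟩
      (δ i * (u⁻ ∙ S i) + φ i * s) + u⁺ i
        ≈⟨ +-congʳ (∙-linear u⁻ (δ i) (S i) (φ i) (λ _ → 1#)) ⟨
      u⁻ ∙ A i + u⁺ i
        ≈⟨ +-congʳ (trans (∙-comm u⁻ (A i)) (∙-linear (A i) 1# u (- ε) (u ∘ σ))) ⟩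
      (1# * (A i ∙ u) + - ε * (A i ∙ (u ∘ σ))) + u⁺ i
        ≈⟨ solve 5 (λ a b ε x y → (con (+ 1) :* a :+ :- ε :* b) :+ (x :+ ε :* y) :=
             con (+ 1) :* (con (+ 1) :* a :+ :- ε :* b) :+ con (+ 1) :* (con (+ 1) :* x :+ ε :* y)) refl
             (A i ∙ u) (A i ∙ (u ∘ σ)) ε (u i) (u (σ i)) ⟩
      1# * (1# * (A i ∙ u) + - ε * (A i ∙ (u ∘ σ))) + 1# * (1# * u i + ε * u (σ i))
        ≈⟨ +-cong (*-congˡ (+-cong (*-congˡ (∙-comm u (A i))) (*-congˡ (∙-∘σ′ (A i)))))
                  (*-congˡ (+-cong (*-congˡ (trans (∙-comm u (1ᴹ i)) (1ᴹ-∙ i u)))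
                                   (*-congˡ (trans (∙-∘σ′ (1ᴹ i)) (1ᴹ-∙ i (u ∘ σ)))))) ⟨
      1# * (1# * (u ∙ A i) + - ε * (u ∙ (A i ∘ σ))) + 1# * (1# * (u ∙ 1ᴹ i) + ε * (u ∙ (1ᴹ i ∘ σ)))
        ≈⟨ +-cong (*-congˡ (∙-linear u 1# (A i) (- ε) (A i ∘ σ))) (*-congˡ (∙-linear u 1# (1ᴹ i) ε (1ᴹ i ∘ σ))) ⟨
      1# * (u ∙ (λ j → 1# * A i j + - ε * A i (σ j))) + 1# * (u ∙ (λ j → 1# * 1ᴹ i j + ε * 1ᴹ i (σ j)))
        ≈⟨ ∙-linear u 1# (λ j → 1# * A i j + - ε * A i (σ j)) 1# (λ j → 1# * 1ᴹ i j + ε * 1ᴹ i (σ j)) ⟨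
      u ∙ M i
        ≈⟨ ∙-comm u (M i) ⟩
      M i ∙ u
        ≈⟨ u∈ker i ⟩
      0# ∎

    u-σσ : ∀ k → u (σ (σ k)) ≈ u k
    u-σσ k = reflexive (≡.cong u (involutive k))

    u⁺-∘σ : ∀ k → u⁺ (σ k) ≈ ε * u⁺ k
    u⁺-∘σ k = begin
      u (σ k) + ε * u (σ (σ k))        ≈⟨ +-cong (trans (sym (*-identityˡ _)) (*-congʳ (sym ε²))) (*-congˡ (u-σσ k)) ⟩
      ε * ε * u (σ k) + ε * u k        ≈⟨ solve 3 (λ e x y → e :* e :* x :+ e :* y := e :* (y :+ e :* x)) refl ε (u (σ k)) (u k) ⟩
      ε * (u k + ε * u (σ k))          ∎

    u⁻-∘σ : ∀ k → u⁻ (σ k) ≈ - ε * u⁻ k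
    u⁻-∘σ k = begin
      1# * u (σ k) + - ε * u (σ (σ k))   ≈⟨ +-cong (*-congʳ (sym ε²)) (*-congˡ (u-σσ k)) ⟩
      ε * ε * u (σ k) + - ε * u k
        ≈⟨ solve 3 (λ e x y → e :* e :* x :+ :- e :* y := :- e :* (con (+ 1) :* y :+ :- e :* x)) refl ε (u (σ k)) (u k) ⟩
      - ε * (1# * u k + - ε * u (σ k))   ∎

    X-∘σ : ∀ i → X (σ i) ≈ ε * X i
    X-∘σ i = begin
      X (σ i)                          ≈⟨ S-∘σ u⁻ i ⟩
      - (S i ∙ (u⁻ ∘ σ))               ≈⟨ -‿cong (∙-congˡ (S i) u⁻-∘σ) ⟩
      - (S i ∙ (λ j → - ε * u⁻ j))     ≈⟨ -‿cong (∙-scaleʳ (S i) (- ε) u⁻) ⟩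
      - (- ε * X i)                    ≈⟨ solve 2 (λ e x → :- (:- e :* x) := e :* x) refl ε (X i) ⟩
      ε * X i                          ∎

    s≈-εs : s ≈ - ε * s
    s≈-εs = begin
      u⁻ ∙ (λ _ → 1#)                   ≈⟨ sum-permute (λ k → u⁻ k * 1#) π ⟩
      (u⁻ ∘ σ) ∙ (λ _ → 1#)             ≈⟨ ∙-congʳ (λ _ → 1#) u⁻-∘σ ⟩
      (λ k → - ε * u⁻ k) ∙ (λ _ → 1#)   ≈⟨ ∙-comm (λ k → - ε * u⁻ k) (λ _ → 1#) ⟩
      (λ _ → 1#) ∙ (λ k → - ε * u⁻ k)   ≈⟨ ∙-scaleʳ (λ _ → 1#) (- ε) u⁻ ⟩
      - ε * ((λ _ → 1#) ∙ u⁻)           ≈⟨ *-congˡ (∙-comm (λ _ → 1#) u⁻) ⟩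
      - ε * s                           ∎

    s+εs≈0 : s + ε * s ≈ 0#
    s+εs≈0 = trans (+-congʳ s≈-εs) (solve 2 (λ e s → :- e :* s :+ e :* s := con (+ 0)) refl ε s)

    equation-∘σ : ∀ i → (- δ i * (ε * X i) + φ i * s) + ε * u⁺ i ≈ 0#
    equation-∘σ i = trans
      (sym (+-cong (+-cong (*-cong (δ-∘σ i) (X-∘σ i)) (*-congʳ (φ-∘σ i))) (u⁺-∘σ i)))
      (equation (σ i))

    -- Adding `ε` times the equation at `σ i` doubles `u⁺` and cancels the part in the
    -- (-`ε`)-eigenspace.
    u⁺≈0 : ∀ i → u⁺ i ≈ 0#
    u⁺≈0 i = x+x≈0⇒x≈0 (begin
      u⁺ i + u⁺ i
        ≈⟨ solve 6 (λ u e d x f s → u :+ u :=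
             (((d :* x :+ f :* s) :+ u) :+ e :* ((:- d :* (e :* x) :+ f :* s) :+ e :* u))
             :- ((con (+ 1) :- e :* e) :* (d :* x :- u) :+ f :* (s :+ e :* s))) refl (u⁺ i) ε (δ i) (X i) (φ i) s ⟩
      (((δ i * X i + φ i * s) + u⁺ i) + ε * ((- δ i * (ε * X i) + φ i * s) + ε * u⁺ i))
        - ((1# - ε * ε) * (δ i * X i - u⁺ i) + φ i * (s + ε * s))
        ≈⟨ +-cong (+-cong (equation i) (*-congˡ (equation-∘σ i)))
                  (-‿cong (+-cong (*-congʳ (+-congˡ (-‿cong ε²))) (*-congˡ s+εs≈0))) ⟩
      (0# + ε * 0#) - ((1# - 1#) * (δ i * X i - u⁺ i) + φ i * 0#)
        ≈⟨ solve 3 (λ e t f → (con (+ 0) :+ e :* con (+ 0)) :- ((con (+ 1) :- con (+ 1)) :* t :+ f :* con (+ 0)) := con (+ 0)) refl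
             ε (δ i * X i - u⁺ i) (φ i) ⟩
      0# ∎)

    δX+φs≈0 : ∀ i → δ i * X i + φ i * s ≈ 0#
    δX+φs≈0 i = begin
      δ i * X i + φ i * s             ≈⟨ +-identityʳ _ ⟨
      δ i * X i + φ i * s + 0#        ≈⟨ +-congˡ (u⁺≈0 i) ⟨
      δ i * X i + φ i * s + u⁺ i      ≈⟨ equation i ⟩
      0#                              ∎

    -- For even `n` the entries of `u⁻` cancel in pairs. For odd `n` the row of a fixed point `o` is
    -- the sum equation itself, as `δ o` is 0 and `φ o` is 1.
    s≈0 : s ≈ 0#
    s≈0 = [ even , odd ]′ parity
      where
      even : sign (suc r) ≈ 1# × (∀ i → σ i ≢ i) → s ≈ 0#
      even (ε≈1 , _) = x≈-x⇒x≈0 (trans s≈-εs (trans (*-congʳ (-‿cong ε≈1)) (solve 1 (λ s → :- con (+ 1) :* s := :- s) refl s)))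

      odd : sign (suc r) ≈ - 1# × ∃[ o ] σ o ≡ o → s ≈ 0#
      odd (_ , o , σo≡o) = begin
        s
          ≈⟨ solve 2 (λ s x → s := con (+ 0) :* x :+ (con (+ 1) :- con (+ 0) :* con (+ 0)) :* s) refl s (X o) ⟩
        0# * X o + (1# - 0# * 0#) * s
          ≈⟨ +-cong (*-congʳ δo≈0) (*-congʳ (+-congˡ (-‿cong (*-cong δo≈0 δo≈0)))) ⟨
        δ o * X o + φ o * s
          ≈⟨ δX+φs≈0 o ⟩
        0# ∎
        where δo≈0 = δ-fixed σo≡o

    X≈0 : ∀ i → X i ≈ 0#
    X≈0 i = decide (σ i ≟ i)
      where
      decide : Dec (σ i ≡ i) → X i ≈ 0#
      decide (yes σi≡i) = fixed⇒≈0 σi≡i (trans (reflexive (≡.cong X (≡.sym σi≡i))) (X-∘σ i))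
      decide (no σi≢i)  = begin
        X i                               ≈⟨ *-identityˡ _ ⟨
        1# * X i                          ≈⟨ *-congʳ (δ²-moved σi≢i) ⟨
        δ i * δ i * X i                   ≈⟨ solve 3 (λ d x f → d :* d :* x := d :* (d :* x :+ f :* con (+ 0))) refl (δ i) (X i) (φ i) ⟩
        δ i * (δ i * X i + φ i * 0#)      ≈⟨ *-congˡ (+-congˡ (*-congˡ s≈0)) ⟨
        δ i * (δ i * X i + φ i * s)       ≈⟨ *-congˡ (δX+φs≈0 i) ⟩
        δ i * 0#                          ≈⟨ zeroʳ _ ⟩
        0#                                ∎

    w∙u⁻≈0 : ∀ k → w k ∙ u⁻ ≈ 0#
    w∙u⁻≈0 zero = begin
      w 0 ∙ u⁻            ≈⟨ ∙-congʳ u⁻ w-zero ⟩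
      (λ _ → 1#) ∙ u⁻     ≈⟨ ∙-comm (λ _ → 1#) u⁻ ⟩
      s                   ≈⟨ s≈0 ⟩
      0#                  ∎
    w∙u⁻≈0 (suc k) = begin
      w (suc k) ∙ u⁻             ≈⟨ ∙-congʳ u⁻ (w-suc k) ⟩
      (S *ⱽ w k) ∙ u⁻            ≈⟨ solve 1 (λ x → x := :- (:- x)) refl _ ⟩
      - - ((S *ⱽ w k) ∙ u⁻)      ≈⟨ -‿cong (S-skewAdjoint (w k) u⁻) ⟨
      - (w k ∙ X)                ≈⟨ -‿cong (∙-zeroʳ (w k) X≈0) ⟩
      - 0#                       ≈⟨ solve 0 (:- con (+ 0) := con (+ 0)) refl ⟩
      0#                         ∎

    u⁻∈ker : Kernel (W ᵀ) u⁻
    u⁻∈ker k = w∙u⁻≈0 (toℕ k)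

  module _ (v : Vector Carrier (suc r)) (v∈ker : Kernel (W ᵀ) v) (v≉0 : Nonzero v) (v∙v≈0 : v ∙ v ≈ 0#) where

    private
      i₀ = proj₁ v≉0
      vi₀≉0 = proj₂ v≉0

    vσ≈εv : ∀ k → v (σ k) ≈ ε * v k
    vσ≈εv = isotropic⇒parity v v∈ker v≉0 v∙v≈0

    δ²v≈v : ∀ i → δ i * δ i * v i ≈ v i
    δ²v≈v i = decide (σ i ≟ i)
      where
      decide : Dec (σ i ≡ i) → δ i * δ i * v i ≈ v i
      decide (no σi≢i)  = trans (*-congʳ (δ²-moved σi≢i)) (*-identityˡ _)
      decide (yes σi≡i) = trans (*-congˡ vi≈0) (trans (zeroʳ _) (sym vi≈0))
        where vi≈0 = fixed⇒≈0 σi≡i (trans (reflexive (≡.cong v (≡.sym σi≡i))) (vσ≈εv i))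

    -- Multiplication by `δ` carries `v` to the (-`ε`)-eigenspace, where the second summand of `M`
    -- contributes nothing. It also undoes the `δ` in `A` and kills the `φ` part, so that zᵀA
    -- reduces to -(`S v`)ᵀ, which is 0.
    z : Vector Carrier (suc r)
    z i = δ i * v i

    z≉0 : Nonzero z
    z≉0 = i₀ , λ zi₀≈0 → vi₀≉0 (begin
      v i₀                  ≈⟨ δ²v≈v i₀ ⟨
      δ i₀ * δ i₀ * v i₀    ≈⟨ *-assoc _ _ _ ⟩
      δ i₀ * z i₀           ≈⟨ *-congˡ zi₀≈0 ⟩
      δ i₀ * 0#             ≈⟨ zeroʳ _ ⟩
      0#                    ∎)

    z-∘σ : ∀ k → z k + ε * z (σ k) ≈ 0#
    z-∘σ k = begin
      δ k * v k + ε * (δ (σ k) * v (σ k))     ≈⟨ +-congˡ (*-congˡ (*-cong (δ-∘σ k) (vσ≈εv k))) ⟩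
      δ k * v k + ε * (- δ k * (ε * v k))
        ≈⟨ solve 3 (λ d v e → d :* v :+ e :* (:- d :* (e :* v)) := (con (+ 1) :- e :* e) :* (d :* v)) refl (δ k) (v k) ε ⟩
      (1# - ε * ε) * (δ k * v k)              ≈⟨ *-congʳ (trans (+-congˡ (-‿cong ε²)) (-‿inverseʳ 1#)) ⟩
      0# * (δ k * v k)                        ≈⟨ zeroˡ _ ⟩
      0#                                      ∎

    z∙A≈0 : ∀ j → z ∙ (λ i → A i j) ≈ 0#
    z∙A≈0 j = begin
      z ∙ (λ i → A i j)
        ≈⟨ sum-cong-≋ term ⟩
      (λ i → - S j i) ∙ v
        ≈⟨ neg-∙ (S j) v ⟩
      - (S *ⱽ v) j
        ≈⟨ -‿cong (Sv≈0 v v∈ker v≉0 j) ⟩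
      - 0#
        ≈⟨ solve 0 (:- con (+ 0) := con (+ 0)) refl ⟩
      0# ∎
      where
      term : ∀ i → z i * A i j ≈ - S j i * v i
      term i = begin
        δ i * v i * (δ i * S i j + φ i * 1#)
          ≈⟨ solve 4 (λ d v s f → d :* v :* (d :* s :+ f :* con (+ 1)) := s :* (d :* d :* v) :+ (f :* d) :* v) refl (δ i) (v i) (S i j) (φ i) ⟩
        S i j * (δ i * δ i * v i) + (φ i * δ i) * v i
          ≈⟨ +-cong (*-cong (skew i j) (δ²v≈v i)) (*-congʳ (φδ≈0 i)) ⟩
        - S j i * v i + 0# * v i
          ≈⟨ solve 2 (λ s v → s :* v :+ con (+ 0) :* v := s :* v) refl (- S j i) (v i) ⟩
        - S j i * v i ∎

    z∈ker : Kernel (M ᵀ) z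
    z∈ker j = begin
      (λ i → M i j) ∙ z
        ≈⟨ ∙-comm (λ i → M i j) z ⟩
      z ∙ (λ i → M i j)
        ≈⟨ ∙-linear z 1# (λ i → 1# * A i j + - ε * A i (σ j)) 1# (λ i → 1# * 1ᴹ i j + ε * 1ᴹ i (σ j)) ⟩
      1# * (z ∙ (λ i → 1# * A i j + - ε * A i (σ j))) + 1# * (z ∙ (λ i → 1# * 1ᴹ i j + ε * 1ᴹ i (σ j)))
        ≈⟨ +-cong (*-congˡ (∙-linear z 1# (λ i → A i j) (- ε) (λ i → A i (σ j))))
                  (*-congˡ (∙-linear z 1# (λ i → 1ᴹ i j) ε (λ i → 1ᴹ i (σ j)))) ⟩
      1# * (1# * (z ∙ (λ i → A i j)) + - ε * (z ∙ (λ i → A i (σ j))))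
        + 1# * (1# * (z ∙ (λ i → 1ᴹ i j)) + ε * (z ∙ (λ i → 1ᴹ i (σ j))))
        ≈⟨ +-cong (*-congˡ (+-cong (*-congˡ (z∙A≈0 j)) (*-congˡ (z∙A≈0 (σ j)))))
                  (*-congˡ (+-cong (*-congˡ (∙-1ᴹ z j)) (*-congˡ (∙-1ᴹ z (σ j))))) ⟩
      1# * (1# * 0# + - ε * 0#) + 1# * (1# * z j + ε * z (σ j))
        ≈⟨ solve 3 (λ e x y → con (+ 1) :* (con (+ 1) :* con (+ 0) :+ :- e :* con (+ 0)) :+ con (+ 1) :* (con (+ 1) :* x :+ e :* y)
             := x :+ e :* y) refl ε (z j) (z (σ j)) ⟩
      z j + ε * z (σ j)
        ≈⟨ z-∘σ j ⟩
      0# ∎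

    -- `u⁻` lies in the left kernel of `W` and is thus proportional to `v`, but `σ` acts on it by
    -- -`ε` and on `v` by `ε`. Hence the entrywise product of the two vanishes, and where `v` is 0,
    -- comparison with the index `i₀` shows that `u⁻` is 0 too.
    kernel≈0 : ∀ u → Kernel M u → ∀ k → u k ≈ 0#
    kernel≈0 u u∈ker k = x+x≈0⇒x≈0 (begin
      u k + u k
        ≈⟨ solve 3 (λ x y e → x :+ x := (x :+ e :* y) :+ (con (+ 1) :* x :+ :- e :* y)) refl (u k) (u (σ k)) ε ⟩
      u⁺ k + u⁻ k
        ≈⟨ +-cong (u⁺≈0 k) u⁻≈0 ⟩
      0# + 0#
        ≈⟨ +-identityˡ 0# ⟩
      0# ∎)
      where
      open RightKernel u u∈ker

      u⁻v≈0 : u⁻ k * v k ≈ 0#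
      u⁻v≈0 = begin
        u⁻ k * v k              ≈⟨ *-identityˡ _ ⟨
        1# * (u⁻ k * v k)       ≈⟨ *-congʳ ε² ⟨
        ε * ε * (u⁻ k * v k)    ≈⟨ *-assoc _ _ _ ⟩
        ε * (ε * (u⁻ k * v k))  ≈⟨ *-congˡ (x≈-x⇒x≈0 opposite) ⟩
        ε * 0#                  ≈⟨ zeroʳ _ ⟩
        0#                      ∎
        where
        opposite : ε * (u⁻ k * v k) ≈ - (ε * (u⁻ k * v k))
        opposite = begin
          ε * (u⁻ k * v k)      ≈⟨ solve 3 (λ e x y → e :* (x :* y) := x :* (e :* y)) refl ε (u⁻ k) (v k) ⟩
          u⁻ k * (ε * v k)      ≈⟨ *-congˡ (vσ≈εv k) ⟨
          u⁻ k * v (σ k)        ≈⟨ proportional u⁻ v u⁻∈ker v∈ker k (σ k) ⟩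
          u⁻ (σ k) * v k        ≈⟨ *-congʳ (u⁻-∘σ k) ⟩
          - ε * u⁻ k * v k      ≈⟨ solve 3 (λ e x y → :- e :* x :* y := :- (e :* (x :* y))) refl ε (u⁻ k) (v k) ⟩
          - (ε * (u⁻ k * v k))  ∎

      u⁻≈0 : u⁻ k ≈ 0#
      u⁻≈0 = [ id , (λ vk≈0 → *-cancel-≉0 vi₀≉0 (begin
        v i₀ * u⁻ k    ≈⟨ *-comm _ _ ⟩
        u⁻ k * v i₀    ≈⟨ proportional u⁻ v u⁻∈ker v∈ker k i₀ ⟩
        u⁻ i₀ * v k    ≈⟨ *-congˡ vk≈0 ⟩
        u⁻ i₀ * 0#     ≈⟨ zeroʳ _ ⟩
        0#             ∎)) ]′ (integral u⁻v≈0)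

    notIsotropic : ⊥
    notIsotropic =
      let u , (k , uk≉0) , u∈ker = leftKernel⇒kernel M z z≉0 z∈ker
      in  uk≉0 (kernel≈0 u u∈ker k)

-- The parity of `n` and involutions without fixed points

halve : ∀ n → ∃[ k ] (n ≡ k ℕ.+ k ⊎ n ≡ suc (k ℕ.+ k))
halve zero    = 0 , inj₁ ≡.refl
halve (suc n) with halve n
... | k , inj₁ n≡2k   = k , inj₂ (≡.cong suc n≡2k)
... | k , inj₂ n≡1+2k = suc k , inj₁ (≡.cong suc (≡.trans n≡1+2k (≡.sym (ℕ.+-suc k k))))

-- Exactly one element of each orbit lies below its image, so half of `n` is the number of such
-- elements.
noFixedPoint⇒even : ∀ {n} (π : Permutation′ n) → (∀ i → π ⟨$⟩ʳ (π ⟨$⟩ʳ i) ≡ i) → (∀ i → π ⟨$⟩ʳ i ≢ i) →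
                    ∃[ k ] n ≡ k ℕ.+ k
noFixedPoint⇒even {n} π involutive noFixedPoint = sum below , (begin
  n                                    ≡⟨ sum-1 n ⟨
  sum {n} (λ _ → 1)                    ≡⟨ sum-cong-≗ below+below∘σ ⟨
  sum (λ i → below i ℕ.+ below (σ i))  ≡⟨ ∑-distrib-+ below (below ∘ σ) ⟩
  sum below ℕ.+ sum (below ∘ σ)        ≡⟨ ≡.cong (sum below ℕ.+_) (sum-permute below π) ⟨
  sum below ℕ.+ sum below              ∎)
  where
  open import Algebra.Properties.CommutativeMonoid.Sum ℕ.+-0-commutativeMonoid
  open ≡.≡-Reasoning

  σ : Fin n → Fin n
  σ = π ⟨$⟩ʳ_

  below : Fin n → ℕ
  below i with <-cmp i (σ i)
  ... | tri< _ _ _ = 1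
  ... | tri≈ _ _ _ = 0
  ... | tri> _ _ _ = 0

  sum-1 : ∀ n → sum {n} (λ _ → 1) ≡ n
  sum-1 zero    = ≡.refl
  sum-1 (suc n) = ≡.cong suc (sum-1 n)

  below+below∘σ : ∀ i → below i ℕ.+ below (σ i) ≡ 1
  below+below∘σ i with <-cmp i (σ i) | <-cmp (σ i) (σ (σ i))
  ... | tri< _ _ _    | tri> _ _ _   = ≡.refl
  ... | tri> _ _ _    | tri< _ _ _   = ≡.refl
  ... | tri≈ _ i≡σi _ | _            = contradiction (≡.sym i≡σi) (noFixedPoint i)
  ... | _             | tri≈ _ eq _  = contradiction (≡.sym eq) (noFixedPoint (σ i))
  ... | tri< _ _ σi≮i | tri< lt _ _  = contradiction (≡.subst (σ i <_) (involutive i) lt) σi≮i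
  ... | tri> i≮σi _ _ | tri> _ _ gt  = contradiction (≡.subst (_< σ i) (involutive i) gt) i≮σi

-- The two domains, and the walk vectors of an oriented graph

ℤ-domain : DecidableDomain 0ℓ 0ℓ
ℤ-domain = record
  { commutativeRing = ℤ.+-*-commutativeRing
  ; _≈?_            = ℤ._≟_
  ; integral        = λ {x} → ℤ.i*j≡0⇒i≡0∨j≡0 x
  ; 1+1≉0           = λ ()
  }

module _ {p : ℕ} where

  Congruent-0⇒∣ : ∀ {x} → Congruent p x 0ℤ → p ∣ ℤ.∣ x ∣
  Congruent-0⇒∣ {x} (congruent p∣x-0) = ≡.subst (λ y → p ∣ ℤ.∣ y ∣) (ℤ.+-identityʳ x) (ℤ.∣⇒∣ᵤ p∣x-0)

  ∣⇒Congruent-0 : ∀ {x} → p ∣ ℤ.∣ x ∣ → Congruent p x 0ℤ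
  ∣⇒Congruent-0 {x} p∣x = congruent (≡.subst (+ p ℤ.∣_) (≡.sym (ℤ.+-identityʳ x)) (ℤ.∣ᵤ⇒∣ p∣x))

ℤ/-domain : ∀ p → Prime p → ¬ (2 ∣ p) → DecidableDomain 0ℓ 0ℓ
ℤ/-domain p p-prime 2∤p = record
  { commutativeRing = ℤ/ p
  ; _≈?_            = λ x y → map′ congruent Congruent.p∣x-y (+ p ℤ.∣? x ℤ.- y)
  ; integral        = λ {x} {y} xy≈0 → Sum.map ∣⇒Congruent-0 ∣⇒Congruent-0
      (euclidsLemma ℤ.∣ x ∣ ℤ.∣ y ∣ p-prime (≡.subst (p ∣_) (ℤ.abs-* x y) (Congruent-0⇒∣ xy≈0)))
  ; 1+1≉0           = λ 2≈0 → p∤2 (Congruent-0⇒∣ 2≈0)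
  }
  where
  p∤2 : ¬ (p ∣ 2)
  p∤2 p∣2 = 2∤p (≡.subst (_∣ p) (ℕ.≤-antisym (ℕ.∣⇒≤ p∣2) (ℕ.nonTrivial⇒n>1 p {{prime⇒nonTrivial p-prime}})) ℕ.∣-refl)

module _ {n : ℕ} (Σ : OrientedGraph n) where

  open OrientedGraph Σ
  open Overℤ
  open FiniteSums ℤ.+-*-commutativeRing

  private
    S = skewAdjacency Σ

  skewAdjacency-skew : ∀ i j → S i j ≡ ℤ.- S j i
  skewAdjacency-skew i j with i ⟶? j | j ⟶? i
  ... | yes i⟶j | yes j⟶i = contradiction j⟶i (asym i⟶j)
  ... | yes _   | no _    = ≡.refl
  ... | no _    | yes _   = ≡.refl
  ... | no _    | no _    = ≡.refl

  skewAdjacency-anti : ∀ {π} → permutationMatrix π ᵀ *ᴹ S *ᴹ permutationMatrix π ≈ᴹ S ᵀ →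
                       ∀ i j → S (π ⟨$⟩ʳ i) (π ⟨$⟩ʳ j) ≡ ℤ.- S i j
  skewAdjacency-anti {π} PᵀSP≡Sᵀ i j = begin
    S (π ⟨$⟩ʳ i) (π ⟨$⟩ʳ j)          ≡⟨ skewAdjacency-skew _ _ ⟩
    ℤ.- S (π ⟨$⟩ʳ j) (π ⟨$⟩ʳ i)      ≡⟨ ≡.cong ℤ.-_ (PᵀSP≡Sᵀ (π ⟨$⟩ʳ i) (π ⟨$⟩ʳ j)) ⟨
    ℤ.- (permutationMatrix π ᵀ *ᴹ S *ᴹ permutationMatrix π) (π ⟨$⟩ʳ i) (π ⟨$⟩ʳ j)
                                     ≡⟨ ≡.cong ℤ.-_ (permutationMatrix-conjugate π S i j) ⟩
    ℤ.- S i j                        ∎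
    where
    open ≡.≡-Reasoning

  walkVector : ℕ → Vector ℤ n
  walkVector k = (S ^ᴹ k) *ⱽ replicate n 1ℤ

  walkVector-zero : ∀ i → walkVector 0 i ≡ 1ℤ
  walkVector-zero i = 1ᴹ-∙ i (replicate n 1ℤ)

  walkVector-suc : ∀ k i → walkVector (suc k) i ≡ (S *ⱽ walkVector k) i
  walkVector-suc k i = *ᴹ-*ⱽ-assoc S (S ^ᴹ k) (replicate n 1ℤ) i

theorem1p8 : (n : ℕ) (Σ : OrientedGraph n) →
    SelfConverse Σ →
    Overℤ.det (walkMatrix Σ) ≢ 0ℤ →
    (p : ℕ) → Prime p → ¬ (2 ∣ p) →
    (r : ℕ) → suc r ≡ n → Over𝔽.HasRank p (walkMatrix Σ mod p) r →
    Over𝔽.Anisotropic p (Over𝔽.Kernel p ((walkMatrix Σ mod p) ᵀ))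
theorem1p8 .(suc r) Σ (π , PᵀSP≡Sᵀ) det≢0 p p-prime 2∤p r ≡.refl rank v v∈ker v≋̸0 v∙v≈0 =
  -- The hypothesis on `v` names no nonzero coordinate. Since the goal is ⊥, it is enough to refute
  -- that one exists.
  v≋̸0 (𝔽.¬Nonzero⇒≈0 λ v≉0 → notIsotropic v v∈ker v≉0 v∙v≈0)
  where
  𝔽-domain = ℤ/-domain p p-prime 2∤p
  module 𝔽 = DomainLinearAlgebra 𝔽-domain
  open CommutativeRing (ℤ/ p) using (reflexive; -‿cong)
  module ℤ-Sign = Sign ℤ.+-*-commutativeRing
  open Sign (ℤ/ p)

  anti = skewAdjacency-anti Σ {π} PᵀSP≡Sᵀ

  walkℤ : SkewWalk ℤ-domain (suc r)
  walkℤ = record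
    { S      = skewAdjacency Σ
    ; skew   = skewAdjacency-skew Σ
    ; π      = π
    ; anti   = anti
    ; w      = walkVector Σ
    ; w-zero = walkVector-zero Σ
    ; w-suc  = walkVector-suc Σ
    }

  walk𝔽 : SkewWalk 𝔽-domain (suc r)
  walk𝔽 = record
    { S      = skewAdjacency Σ
    ; skew   = λ i j → reflexive (skewAdjacency-skew Σ i j)
    ; π      = π
    ; anti   = λ i j → reflexive (anti i j)
    ; w      = walkVector Σ
    ; w-zero = λ i → reflexive (walkVector-zero Σ i)
    ; w-suc  = λ k i → reflexive (walkVector-suc Σ k i)
    }

  open NonsingularWalkMatrix walkℤ det≢0 using (σ-involutive; even⇒noFixedPoint)
  open SkewWalk walk𝔽 using (σ; FixedPointParity)

  parity : FixedPointParity
  parity = decide (halve (suc r)) (any? λ i → σ i ≟ i)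
    where
    decide : ∃[ k ] (suc r ≡ k ℕ.+ k ⊎ suc r ≡ suc (k ℕ.+ k)) → Dec (∃[ o ] σ o ≡ o) → FixedPointParity
    decide (k , inj₁ n≡2k) _ =
      inj₁ (sign-even k n≡2k , even⇒noFixedPoint (ℤ-Sign.sign-even k n≡2k))
    decide (k , inj₂ n≡1+2k) (yes fixed) =
      inj₂ (-‿cong (sign-even k (ℕ.suc-injective n≡1+2k)) , fixed)
    -- Without a fixed point `n` would also be even, and the sign of `n` in ℤ would be both 1 and
    -- -1.
    decide (k , inj₂ n≡1+2k) (no ¬fixed) =
      let l , n≡2l = noFixedPoint⇒even π σ-involutive (λ i σi≡i → ¬fixed (i , σi≡i))
      in  contradiction
            (≡.trans (≡.sym (ℤ-Sign.sign-even l n≡2l)) (≡.cong ℤ.-_ (ℤ-Sign.sign-even k (ℕ.suc-injective n≡1+2k))))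
            λ ()

  open IsotropicKernel walk𝔽 rank σ-involutive parity using (notIsotropic)
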